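{- Let $q \ge 1$ be an integer and let $a,b,c$ be admissible residue classes modulo $q$. Then $N(x;q,[a,b,c]) \to \infty$ as $x \to \infty$; equivalently, there are infinitely many $n$ with $E_n \equiv a$, $E_{n+1} \equiv b$, $E_{n+2} \equiv c \pmod q$.
   Context: Let $\mathbf E = \{m^2 + l^2 : m,l \text{ nonnegative integers}\}$ be the set of sums of two squares, and let $E_1 < E_2 < E_3 < \cdots$ be its elements listed in increasing order. A residue class $a$ modulo $q$ is called admissible if the congruence $x^2 + y^2 \equiv a \pmod q$ has a solution in integers $x,y$. For an $r$-tuple $\mathbf a = [a_1,\dots,a_r]$ of admissible residue classes modulo $q$, define $N(x;q,\mathbf a) := \#\{E_n \le x : E_{n+i-1} \equiv a_i \pmod q \text{ for all } 1 \le i \le r\}$. -}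

module Defs where

open import Data.Nat using (ℕ; _+_; _*_; _<_; _≤_; _%_; NonZero)
open import Data.Product using (∃₂; _×_)
open import Relation.Binary.PropositionalEquality using (_≡_)
open import Relation.Nullary using (¬_)

InE : ℕ → Set
InE m = ∃₂ λ x y → x * x + y * y ≡ m

-- a is admissible modulo q: x^2 + y^2 ≡ a (mod q) is solvable.
-- (Solvability over ℤ equals solvability over ℕ since squares mod q
--  only depend on x mod q, which has a nonnegative representative.)
Admissible : (q : ℕ) → .{{NonZero q}} → ℕ → Set
Admissible q a = ∃₂ λ x y → (x * x + y * y) % q ≡ a % q

ConsecE : ℕ → ℕ → Set
ConsecE e f = InE e × InE f × e < f × (∀ m → e < m → m < f → ¬ InE m)

-- (e, f, g) = (E_n, E_{n+1}, E_{n+2}) for some n, with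
-- E_n ≡ a, E_{n+1} ≡ b, E_{n+2} ≡ c (mod q).
GoodTriple : (q : ℕ) → .{{NonZero q}} → ℕ → ℕ → ℕ → ℕ → ℕ → ℕ → Set
GoodTriple q a b c e f g =
  ConsecE e f × ConsecE f g ×
  e % q ≡ a % q × f % q ≡ b % q × g % q ≡ c % q

{-# OPTIONS --safe #-}

-- The three sums of two squares are the norms of lattice points Q, P, R ∈ ℤ², and
-- A = Q - P, B = R - P satisfy 2 A·P + |A|² = - h, 2 B·P + |B|² = k, where h = f - e, k = g - f.
-- Start from points with the right residues modulo q.  Each integer f + j strictly between
-- e and g, j ≠ 0, is then removed by passing to another solution with the same h and k,
-- congruent to the old one modulo any prescribed K, for which some prime p ≡ 3 (mod 4)
-- divides f + j exactly once; multiplying K by p² protects this in later steps.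
--
-- To reach the new solution, keep D = det(A, C) fixed and put B = l A + d C.  If
-- m d = |A|² l² - (|A|² + h) l - k, the two linear equations for P = (P₁, P₂) are solved by
-- 2 D (P₁, - P₂) = - (h + |A|²) C' + (m + 2 l A·C + d |C|²) A', where ' swaps the coordinates;
-- this is integral as soon as A, C, l, d, m are congruent modulo 2 D K
-- to the old values A, B, 0, 1, - k.
-- For d = x² + w² with x, w coprime, - 1 is a square modulo d, so the norm form is hyperbolic
-- there and A can be chosen with 2 |A|² ≡ k + 2 h (mod d); with l ≡ 2 (mod d) this makes d
-- divide the quadratic above.  Modulo p² one prescribes A and d C, hence P; points of
-- given norm exist there because every unit is ± a square.
module Submission where

open import Defs
open import Data.Nat using (ℕ; zero; suc; z≤n; s≤s; z<s; s<s; _≤_; NonZero)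
import Data.Nat as ℕ
import Data.Nat.Coprimality as ℕ using (Coprime; coprime-Bézout)
import Data.Nat.Divisibility as ℕ
import Data.Nat.DivMod as ℕ
import Data.Nat.GCD as ℕ using (module Bézout)
import Data.Nat.Properties as ℕ
open import Data.Nat.Induction using (<-rec)
open import Data.Nat.ListAction using (product)
open import Data.Nat.Primality using (Prime; prime⇒irreducible; prime⇒nonZero; prime⇒nonTrivial; euclidsLemma)
open import Data.Nat.Primality.Factorisation using (factorise; module PrimeFactorisation)
open import Data.Integer using (ℤ; +_; -[1+_]; -_; _+_; _*_; _-_; 0ℤ; 1ℤ; -1ℤ; ≢-nonZero) renaming (∣_∣ to abs)
import Data.Integer.DivMod as ℤ
import Data.Integer.Properties as ℤ
open import Data.Integer.Divisibility.Signed using (_∣_; divides; _∣?_; ∣-refl; ∣-trans; ∣m∣n⇒∣m+n; ∣n⇒∣m*n; ∣m⇒∣m*n; ∣m⇒∣-m; ∣⇒∣ᵤ; ∣ᵤ⇒∣; *-monoˡ-∣; *-monoʳ-∣)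
open import Data.Integer.Tactic.RingSolver using (solve; solve-∀)
import Data.Fin as Fin
open import Data.Fin using (Fin; zero; suc; toℕ; fromℕ<)
open import Data.Fin.Properties using (pigeonhole; toℕ<n; toℕ-fromℕ<)
open import Data.List using ([]; _∷_)
open import Data.List.Relation.Unary.All as All using (All)
open import Data.Empty using (⊥; ⊥-elim)
open import Data.Product using (∃; ∃₂; _×_; _,_; proj₁; proj₂; Σ-syntax)
open import Data.Sum using (_⊎_; inj₁; inj₂; [_,_]′)
open import Function using (id)
open import Relation.Binary.PropositionalEquality using (_≡_; _≢_; refl; sym; trans; cong; cong₂; subst; module ≡-Reasoning)
open import Relation.Nullary using (¬_; Dec; yes; no; contradiction)
open import Relation.Nullary.Decidable using (from-no)

-- Congruences of integers

infix 4 _≅_[_]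
record _≅_[_] (a b n : ℤ) : Set where
  constructor ≅!
  field difference : n ∣ a - b
open _≅_[_] renaming (difference to δ) public

-- Memberships in the ideal (n) are proved as p ⊕ q by eq: a combination of known multiples
-- of n, followed by a ring identity.
infixl 5 _by_
_by_ : ∀ {n x y} → n ∣ x → y ≡ x → n ∣ y
p by refl = p

infixl 6 _⊕_
_⊕_ : ∀ {n x y} → n ∣ x → n ∣ y → n ∣ x + y
_⊕_ = ∣m∣n⇒∣m+n

infixl 7 _⊛_
_⊛_ : ∀ {n a b} c → a ≅ b [ n ] → n ∣ c * (a - b)
c ⊛ p = ∣n⇒∣m*n c (δ p)

≅-refl : ∀ {n a} → a ≅ a [ n ]
≅-refl {n} {a} = ≅! (divides 0ℤ (ℤ.+-inverseʳ a))

≅-reflexive : ∀ {n a b} → a ≡ b → a ≅ b [ n ]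
≅-reflexive refl = ≅-refl

≅-sym : ∀ {n a b} → a ≅ b [ n ] → b ≅ a [ n ]
≅-sym {n} {a} {b} p = ≅! (∣m⇒∣-m (δ p) by solve (a ∷ b ∷ []))

≅-trans : ∀ {n a b c} → a ≅ b [ n ] → b ≅ c [ n ] → a ≅ c [ n ]
≅-trans {n} {a} {b} {c} p q = ≅! (δ p ⊕ δ q by solve (a ∷ b ∷ c ∷ []))

+-cong-≅ : ∀ {n a b c d} → a ≅ b [ n ] → c ≅ d [ n ] → a + c ≅ b + d [ n ]
+-cong-≅ {n} {a} {b} {c} {d} p q = ≅! (δ p ⊕ δ q by solve (a ∷ b ∷ c ∷ d ∷ []))

*-cong-≅ : ∀ {n a b c d} → a ≅ b [ n ] → c ≅ d [ n ] → a * c ≅ b * d [ n ]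
*-cong-≅ {n} {a} {b} {c} {d} p q = ≅! (c ⊛ p ⊕ b ⊛ q by solve (a ∷ b ∷ c ∷ d ∷ []))

-‿cong-≅ : ∀ {n a b} → a ≅ b [ n ] → - a ≅ - b [ n ]
-‿cong-≅ {n} {a} {b} p = ≅! (∣m⇒∣-m (δ p) by solve (a ∷ b ∷ []))

≅-weaken : ∀ {m n a b} → m ∣ n → a ≅ b [ n ] → a ≅ b [ m ]
≅-weaken m∣n (≅! p) = ≅! (∣-trans m∣n p)

∣-≅ : ∀ {n a b} → a ≅ b [ n ] → n ∣ b → n ∣ a
∣-≅ {n} {a} {b} p q = δ p ⊕ q by solve (a ∷ b ∷ [])

-- A Bézout identity rather than a condition on divisors: inverses are read off from it, and
-- symmetry and multiplicativity become algebra.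
Coprime : ℤ → ℤ → Set
Coprime a n = ∃₂ λ u v → u * a + v * n ≡ 1ℤ

opaque
  inverse : ∀ {a n} → Coprime a n → ∃ λ b → a * b ≅ 1ℤ [ n ]
  inverse {a} {n} (u , v , e) = u , ≅! (divides (- v) (begin
      a * u - 1ℤ              ≡⟨ cong (λ z → a * u - z) (sym e) ⟩
      a * u - (u * a + v * n) ≡⟨ solve (a ∷ u ∷ v ∷ n ∷ []) ⟩
      - v * n                 ∎))
    where open ≡-Reasoning

opaque
  unit⇒coprime : ∀ {a b n} → a * b ≅ 1ℤ [ n ] → Coprime a n
  unit⇒coprime {a} {b} {n} (≅! (divides t e)) = b , - t , (begin
      b * a + - t * n              ≡⟨ solve (a ∷ b ∷ t ∷ n ∷ []) ⟩
      (a * b - 1ℤ) + 1ℤ - t * n    ≡⟨ cong (λ z → z + 1ℤ - t * n) e ⟩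
      t * n + 1ℤ - t * n           ≡⟨ solve (t ∷ n ∷ []) ⟩
      1ℤ                           ∎)
    where open ≡-Reasoning

coprime-neg : ∀ {a n} → Coprime a n → Coprime (- a) n
coprime-neg {a} (u , v , e) = - u , v , trans (neg-neg u a v _) e
  where
  neg-neg : ∀ u a v n → - u * - a + v * n ≡ u * a + v * n
  neg-neg = solve-∀

coprime-sym : ∀ {a b} → Coprime a b → Coprime b a
coprime-sym {a} {b} (u , v , e) = v , u , trans (ℤ.+-comm (v * b) (u * a)) e

≅-unit : ∀ a b b' {n} → a ≅ b [ n ] → b * b' ≅ 1ℤ [ n ] → a * b' ≅ 1ℤ [ n ]
≅-unit a b b' p e = ≅! (b' ⊛ p ⊕ δ e by solve (a ∷ b ∷ b' ∷ []))

*-unit : ∀ a a' b b' {n} → a * a' ≅ 1ℤ [ n ] → b * b' ≅ 1ℤ [ n ] → (a * b) * (a' * b') ≅ 1ℤ [ n ]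
*-unit a a' b b' e e' = ≅! ((b * b') ⊛ e ⊕ δ e' by solve (a ∷ b ∷ a' ∷ b' ∷ []))

unit-cancel : ∀ a a' b c {n} → a * a' ≅ 1ℤ [ n ] → a * b ≅ a * c [ n ] → b ≅ c [ n ]
unit-cancel a a' b c e p = ≅! (a' ⊛ p ⊕ (c - b) ⊛ e by solve (a ∷ b ∷ c ∷ a' ∷ []))

opaque
  coprime-≅ : ∀ {a b n} → a ≅ b [ n ] → Coprime b n → Coprime a n
  coprime-≅ {a} {b} p c with inverse c
  ... | b' , e = unit⇒coprime {b = b'} (≅-unit a b b' p e)

opaque
  coprime-* : ∀ {a b n} → Coprime a n → Coprime b n → Coprime (a * b) n
  coprime-* {a} {b} c c' with inverse c | inverse c'
  ... | a' , e | b' , e' = unit⇒coprime {b = a' * b'} (*-unit a a' b b' e e')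

coprime-*ˡ : ∀ {a n} b → Coprime (a * b) n → Coprime a n
coprime-*ˡ {a} {n} b (u , v , e) = u * b , v , trans (reorder u v a b n) e
  where
  reorder : ∀ u v a b n → u * b * a + v * n ≡ u * (a * b) + v * n
  reorder u v a b n = solve (u ∷ v ∷ a ∷ b ∷ n ∷ [])

coprime-*ʳ : ∀ {b n} a → Coprime (a * b) n → Coprime b n
coprime-*ʳ {b} {n} a (u , v , e) = u * a , v , trans (reorder u v a b n) e
  where
  reorder : ∀ u v a b n → u * a * b + v * n ≡ u * (a * b) + v * n
  reorder u v a b n = solve (u ∷ v ∷ a ∷ b ∷ n ∷ [])

coprime-1 : ∀ {n} → Coprime 1ℤ n
coprime-1 {n} = 1ℤ , 0ℤ , refl

coprime-cancel : ∀ {a b c n} → Coprime a n → a * b ≅ a * c [ n ] → b ≅ c [ n ]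
coprime-cancel {a} {b} {c} u p with inverse u
... | a' , e = unit-cancel a a' b c e p

private
  crtˡ : ∀ a b m m' → a + m' * (b - a) * m ≅ a [ m ]
  crtˡ a b m m' = ≅! (divides (m' * (b - a)) (solve (a ∷ b ∷ m ∷ m' ∷ [])))

  crtʳ : ∀ a b m m' {n} → m * m' ≅ 1ℤ [ n ] → a + m' * (b - a) * m ≅ b [ n ]
  crtʳ a b m m' e = ≅! ((b - a) ⊛ e by solve (a ∷ b ∷ m ∷ m' ∷ []))

opaque
  crt : ∀ {m n} → Coprime m n → ∀ a b → ∃ λ x → x ≅ a [ m ] × x ≅ b [ n ]
  crt {m} c a b with inverse c
  ... | m' , e = a + m' * (b - a) * m , crtˡ a b m m' , crtʳ a b m m' e

-- Primes congruent to 3 modulo 4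

parity : ∀ n → n ℕ.% 2 ≡ 0 ⊎ n ℕ.% 2 ≡ 1
parity n with n ℕ.% 2 | ℕ.m%n<n n 2
... | 0 | _ = inj₁ refl
... | 1 | _ = inj₂ refl
... | suc (suc _) | s<s (s<s ())

parity-+ : ∀ m n {a b} → m ℕ.% 2 ≡ a → n ℕ.% 2 ≡ b → (m ℕ.+ n) ℕ.% 2 ≡ (a ℕ.+ b) ℕ.% 2
parity-+ m n refl refl = ℕ.%-distribˡ-+ m n 2

3mod4⇒odd : ∀ n → n ℕ.% 4 ≡ 3 → n ℕ.% 2 ≡ 1
3mod4⇒odd n n%4 = begin
  n ℕ.% 2                           ≡⟨ cong (ℕ._% 2) (ℕ.m≡m%n+[m/n]*n n 4) ⟩
  (n ℕ.% 4 ℕ.+ n ℕ./ 4 ℕ.* 4) ℕ.% 2 ≡⟨ cong (λ r → (r ℕ.+ n ℕ./ 4 ℕ.* 4) ℕ.% 2) n%4 ⟩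
  (3 ℕ.+ n ℕ./ 4 ℕ.* 4) ℕ.% 2       ≡⟨ cong (λ r → (3 ℕ.+ r) ℕ.% 2) (sym (ℕ.*-assoc (n ℕ./ 4) 2 2)) ⟩
  (3 ℕ.+ n ℕ./ 4 ℕ.* 2 ℕ.* 2) ℕ.% 2 ≡⟨ ℕ.[m+kn]%n≡m%n 3 (n ℕ./ 4 ℕ.* 2) 2 ⟩
  1 ∎
  where open ≡-Reasoning

3mod4-cofactor : ∀ c n → n ℕ.% 4 ≡ 3 → (c ℕ.* n) ℕ.% 4 ≡ 1 → c ℕ.% 4 ≡ 3
3mod4-cofactor c n n%4 cn%4 = residues (c ℕ.% 4) (ℕ.m%n<n c 4)
  (trans (cong (λ r → (c ℕ.% 4 ℕ.* r) ℕ.% 4) (sym n%4)) (trans (sym (ℕ.%-distribˡ-* c n 4)) cn%4))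
  where
  residues : ∀ r → r ℕ.< 4 → (r ℕ.* 3) ℕ.% 4 ≡ 1 → r ≡ 3
  residues 3 _ _ = refl
  residues (suc (suc (suc (suc _)))) (s<s (s<s (s<s (s<s ())))) _

3mod4⇒2≤ : ∀ n → n ℕ.% 4 ≡ 3 → 2 ℕ.≤ n
3mod4⇒2≤ (suc (suc n)) _ = s≤s (s≤s z≤n)

even-square : ∀ y → y ℕ.% 2 ≡ 0 → suc (y ℕ.* y) ℕ.% 4 ≡ 1
even-square y y%2 = trans (cong (λ y → suc (y ℕ.* y) ℕ.% 4) y≡2z)
  (trans (cong (λ w → suc w ℕ.% 4) (ℕ.[m*n]*[o*p]≡[m*o]*[n*p] z 2 z 2)) (ℕ.[m+kn]%n≡m%n 1 (z ℕ.* z) 4))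
  where
  z = y ℕ./ 2
  y≡2z : y ≡ z ℕ.* 2
  y≡2z = trans (ℕ.m≡m%n+[m/n]*n y 2) (cong (ℕ._+ z ℕ.* 2) y%2)

%ℕ-≅ : ∀ a n .{{_ : ℕ.NonZero n}} → a ≅ + (a ℤ.%ℕ n) [ + n ]
%ℕ-≅ a n = ≅! (divides (a ℤ./ℕ n) (trans (cong (_- + (a ℤ.%ℕ n)) (ℤ.a≡a%ℕn+[a/ℕn]*n a n)) (drop (+ (a ℤ.%ℕ n)) _)))
  where
  drop : ∀ a b → a + b - a ≡ b
  drop = solve-∀

pos-square : ∀ y → + (suc (y ℕ.* y)) ≡ + y * + y + 1ℤ
pos-square y = trans (cong +_ (ℕ.+-comm 1 (y ℕ.* y))) (cong (_+ 1ℤ) (ℤ.pos-* y y))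

square-neg : ∀ x → x * x ≡ - x * - x
square-neg = solve-∀

-- Both `y₀` and n - `y₀` are square roots of -1 modulo n, and as n is odd one of them is even. An
-- even y has y² + 1 ≡ 1 (mod 4), which fixes the class of the cofactor in the descent below.
even-root : ∀ n .{{_ : ℕ.NonZero n}} → n ℕ.% 2 ≡ 1 → ∀ x → + n ∣ x * x + 1ℤ →
  ∃ λ y → y ℕ.< n × y ℕ.% 2 ≡ 0 × n ℕ.∣ suc (y ℕ.* y)
even-root n n-odd x n∣ = choose (parity y₀)
  where
  y₀ = x ℤ.%ℕ n
  y₀<n : y₀ ℕ.< n
  y₀<n = ℤ.n%ℕd<d x n
  from-≅ : ∀ y → x * x ≅ + y * + y [ + n ] → n ℕ.∣ suc (y ℕ.* y)
  from-≅ y e = ∣⇒∣ᵤ (subst (+ n ∣_) (sym (pos-square y))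
    (∣-≅ (+-cong-≅ (≅-sym e) (≅-refl {a = 1ℤ})) n∣))
  choose : y₀ ℕ.% 2 ≡ 0 ⊎ y₀ ℕ.% 2 ≡ 1 → ∃ λ y → y ℕ.< n × y ℕ.% 2 ≡ 0 × n ℕ.∣ suc (y ℕ.* y)
  choose (inj₁ even) = y₀ , y₀<n , even , from-≅ y₀ (*-cong-≅ (%ℕ-≅ x n) (%ℕ-≅ x n))
  choose (inj₂ odd) = y , y<n , y-even (parity y) , from-≅ y (≅-trans (≅-reflexive (square-neg x)) (*-cong-≅ y≅ y≅))
    where
    y = n ℕ.∸ y₀
    y+y₀≡n : y ℕ.+ y₀ ≡ n
    y+y₀≡n = ℕ.m∸n+n≡m (ℕ.<⇒≤ y₀<n)
    y<n : y ℕ.< n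
    -- An odd `y₀` is positive, so n - `y₀` stays below n.
    y<n = ℕ.∸-monoʳ-< {n} {y₀} {0} (pos y₀ odd) (ℕ.<⇒≤ y₀<n)
      where
      pos : ∀ z → z ℕ.% 2 ≡ 1 → 0 ℕ.< z
      pos (suc _) _ = z<s
    y-even : y ℕ.% 2 ≡ 0 ⊎ y ℕ.% 2 ≡ 1 → y ℕ.% 2 ≡ 0
    y-even (inj₁ e) = e
    y-even (inj₂ e) = contradiction (trans (sym n-odd) (trans (cong (ℕ._% 2) (sym y+y₀≡n)) (parity-+ y y₀ e odd))) λ ()
    y≅ : - x ≅ + y [ + n ]
    y≅ = ≅-trans (-‿cong-≅ (%ℕ-≅ x n)) (≅! (divides -1ℤ (trans (neg (+ y₀) (+ y)) (cong (λ z → -1ℤ * + z) y+y₀≡n))))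
      where
      neg : ∀ a b → - a - b ≡ -1ℤ * (b + a)
      neg = solve-∀

-- Descent: an even root y < n of x² + 1 gives a cofactor c < n with c ≡ 3 (mod 4) dividing y² + 1.
3mod4∤x²+1 : ∀ n → n ℕ.% 4 ≡ 3 → ∀ x → ¬ (+ n ∣ x * x + 1ℤ)
3mod4∤x²+1 = <-rec _ λ n rec n%4 x n∣ → descend n rec n%4 x n∣
  where
  descend : ∀ n → (∀ {m} → m ℕ.< n → m ℕ.% 4 ≡ 3 → ∀ x → ¬ (+ m ∣ x * x + 1ℤ)) → n ℕ.% 4 ≡ 3 → ∀ x → ¬ (+ n ∣ x * x + 1ℤ)
  descend n@(suc _) rec n%4 x n∣ with even-root n (3mod4⇒odd n n%4) x n∣
  ... | y , y<n , y-even , ℕ.divides c eq = rec c<n (3mod4-cofactor c n n%4 (trans (cong (ℕ._% 4) (sym eq)) (even-square y y-even)))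
      (+ y) (subst (+ c ∣_) (pos-square y) (∣ᵤ⇒∣ (ℕ.divides n (trans eq (ℕ.*-comm c n)))))
    where
    c<n : c ℕ.< n
    c<n = ℕ.*-cancelʳ-< n c n (begin-strict
      c ℕ.* n           ≡⟨ sym eq ⟩
      suc (y ℕ.* y)     ≤⟨ s≤s (ℕ.*-monoʳ-≤ y (ℕ.<⇒≤ y<n)) ⟩
      1 ℕ.+ y ℕ.* n     <⟨ ℕ.+-monoˡ-< (y ℕ.* n) (3mod4⇒2≤ n n%4) ⟩
      suc y ℕ.* n       ≤⟨ ℕ.*-monoˡ-≤ n y<n ⟩
      n ℕ.* n           ∎)
      where open ℕ.≤-Reasoning

-- Coprimality and primes in ℤ

bézout-ℤ : ∀ x a y b → 1 ℕ.+ y ℕ.* b ≡ x ℕ.* a → + x * + a + - + y * + b ≡ 1ℤ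
bézout-ℤ x a y b eq = begin
  + x * + a + - + y * + b              ≡⟨ cong (_+ - + y * + b) (sym (ℤ.pos-* x a)) ⟩
  + (x ℕ.* a) + - + y * + b            ≡⟨ cong (λ z → + z + - + y * + b) (sym eq) ⟩
  1ℤ + + (y ℕ.* b) + - + y * + b       ≡⟨ cong (λ z → 1ℤ + z + - + y * + b) (ℤ.pos-* y b) ⟩
  1ℤ + + y * + b + - + y * + b         ≡⟨ cancel (+ y) (+ b) ⟩
  1ℤ                                   ∎
  where
  open ≡-Reasoning
  cancel : ∀ y b → 1ℤ + y * b + - y * b ≡ 1ℤ
  cancel = solve-∀

coprime-fromℕ : ∀ {a b} → ℕ.Coprime a b → Coprime (+ a) (+ b)
coprime-fromℕ {a} {b} c with ℕ.coprime-Bézout c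
... | ℕ.Bézout.+- x y eq = + x , - + y , bézout-ℤ x a y b eq
... | ℕ.Bézout.-+ x y eq = coprime-sym {+ b} {+ a} (+ y , - + x , bézout-ℤ y b x a eq)

coprime-abs : ∀ z {n} → Coprime (+ abs z) n → Coprime z n
coprime-abs (+ _)    c = c
coprime-abs -[1+ _ ] c = coprime-neg c

coprime-² : ∀ {a n} → Coprime a n → Coprime a (n * n)
coprime-² c = coprime-sym (coprime-* (coprime-sym c) (coprime-sym c))

opaque
  prime∤⇒coprime : ∀ {p} → Prime p → ∀ {z} → ¬ (+ p ∣ z) → Coprime z (+ p)
  prime∤⇒coprime {p} pp {z} p∤z = coprime-abs z (coprime-fromℕ nat-coprime)
    where
    nat-coprime : ℕ.Coprime (abs z) p
    nat-coprime {d} (d∣z , d∣p) with prime⇒irreducible pp d∣p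
    ... | inj₁ d≡1 = d≡1
    ... | inj₂ refl = contradiction (∣ᵤ⇒∣ d∣z) p∤z

opaque
  prime∣* : ∀ {p} → Prime p → ∀ a b → + p ∣ a * b → + p ∣ a ⊎ + p ∣ b
  prime∣* pp a b p∣ with euclidsLemma (abs a) (abs b) pp (subst (_ ℕ.∣_) (ℤ.abs-* a b) (∣⇒∣ᵤ p∣))
  ... | inj₁ d = inj₁ (∣ᵤ⇒∣ d)
  ... | inj₂ d = inj₂ (∣ᵤ⇒∣ d)

opaque
  divides? : ∀ n z → Dec (n ∣ z)
  divides? n z = n ∣? z

∣unit⇒∣1 : ∀ a b {n} → a * b ≅ 1ℤ [ n ] → n ∣ a → n ∣ 1ℤ
∣unit⇒∣1 a b e n∣a = ∣n⇒∣m*n b n∣a ⊕ -1ℤ ⊛ e by solve (a ∷ b ∷ [])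

division-root : ∀ u v v' {n} → v * v' ≅ 1ℤ [ n ] → n ∣ u * u + v * v → u * v' * (u * v') ≅ -1ℤ [ n ]
division-root u v v' e n∣ = ≅! (∣n⇒∣m*n (v' * v') n∣ ⊕ (- (v * v' + 1ℤ)) ⊛ e by solve (u ∷ v ∷ v' ∷ []))

neg-injective-≅ : ∀ x y {n} → - x ≅ - y [ n ] → x ≅ y [ n ]
neg-injective-≅ x y e = ≅! (-1ℤ ⊛ e by solve (x ∷ y ∷ []))

drop-square : ∀ u v {n} → u * u + v * v ≅ -1ℤ [ n ] → n ∣ u → v * v ≅ -1ℤ [ n ]
drop-square u v e n∣u = ≅! (δ e ⊕ ∣n⇒∣m*n (- u) n∣u by solve (u ∷ v ∷ []))

transpose-square : ∀ u v {n} → u * u + v * v ≅ -1ℤ [ n ] → u * u ≅ -1ℤ - v * v [ n ]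
transpose-square u v e = ≅! (δ e by solve (u ∷ v ∷ []))

transpose-square⁻ : ∀ u v {n} → u * u ≅ -1ℤ - v * v [ n ] → u * u + v * v ≅ -1ℤ [ n ]
transpose-square⁻ u v e = ≅! (δ e by solve (u ∷ v ∷ []))

neg-square-norm : ∀ u v x z {n} → u * u + v * v ≅ -1ℤ [ n ] → x * x ≅ - z [ n ] → u * x * (u * x) + v * x * (v * x) ≅ z [ n ]
neg-square-norm u v x z e e' = ≅! ((x * x) ⊛ e ⊕ -1ℤ ⊛ e' by solve (u ∷ v ∷ x ∷ z ∷ []))

¬∣-coprime : ∀ {p} → Prime p → ∀ {a} → Coprime a (+ p) → ¬ (+ p ∣ a)
¬∣-coprime {p} pp {a} c p∣a with inverse c
... | b , e = ℕ.>⇒∤ (ℕ.nonTrivial⇒n>1 p {{prime⇒nonTrivial pp}}) (∣⇒∣ᵤ (∣unit⇒∣1 a b e p∣a))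

module ThreeModFour {p : ℕ} (pp : Prime p) (p%4 : p ℕ.% 4 ≡ 3) where
  instance
    p-nonZero : ℕ.NonZero p
    p-nonZero = prime⇒nonZero pp

  ≢-1 : ∀ x → ¬ (x * x ≅ -1ℤ [ + p ])
  ≢-1 x e = 3mod4∤x²+1 p p%4 x (δ e)

  opaque
    -- If p did not divide v, then u / v would be a square root of -1 modulo p, which p ≡ 3 (mod 4)
    -- excludes.
    anisotropicʳ : ∀ u v → + p ∣ u * u + v * v → + p ∣ v
    anisotropicʳ u v p∣ with divides? (+ p) v
    ... | yes p∣v = p∣v
    ... | no p∤v with inverse (prime∤⇒coprime pp p∤v)
    ...   | v' , e = ⊥-elim (≢-1 (u * v') (division-root u v v' e p∣))

  anisotropicˡ : ∀ u v → + p ∣ u * u + v * v → + p ∣ u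
  anisotropicˡ u v p∣ = anisotropicʳ v u (p∣ by ℤ.+-comm (v * v) (u * u))

  ∤-small : ∀ j → 0 ℕ.< j → j ℕ.< p → ¬ (+ p ∣ + j)
  ∤-small (suc j) _ j<p d = ℕ.>⇒∤ j<p (∣⇒∣ᵤ d)

  p-odd : p ℕ.% 2 ≡ 1
  p-odd = 3mod4⇒odd p p%4

  2-coprime : Coprime (+ 2) (+ p)
  2-coprime = prime∤⇒coprime pp (∤-small 2 z<s (ℕ.≤∧≢⇒< (3mod4⇒2≤ p p%4) λ { refl → contradiction p%4 λ () }))

  signed : ℕ → ℤ → ℤ
  signed zero    z = z
  signed (suc _) z = - z

  -- i ↦ (-1)ⁱ i² is injective on {0, …, p - 1}, since i and p - i have opposite parity.
  signedSquare : ℕ → ℤ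
  signedSquare i = signed (i ℕ.% 2) (+ i * + i)

  -- Here p would divide (j - i)(j + i). The first factor lies strictly between 0 and p; the second
  -- is positive, below 2 p and even, so it is not the odd number p.
  squares-differ : ∀ i j → i ℕ.< j → j ℕ.< p → i ℕ.% 2 ≡ j ℕ.% 2 → ¬ (+ i * + i ≅ + j * + j [ + p ])
  squares-differ i j i<j j<p same e
    with prime∣* pp (+ j - + i) (+ j + + i) (δ (≅-sym e) by factor (+ i) (+ j))
    where
    factor : ∀ i j → (j - i) * (j + i) ≡ j * j - i * i
    factor = solve-∀
  ... | inj₁ d = ∤-small (j ℕ.∸ i) (ℕ.m<n⇒0<n∸m i<j) (ℕ.≤-<-trans (ℕ.m∸n≤m j i) j<p)
                   (subst (+ p ∣_) (trans (ℤ.m-n≡m⊖n j i) (ℤ.⊖-≥ (ℕ.<⇒≤ i<j))) d)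
  ... | inj₂ d with ∣⇒∣ᵤ d
  ...   | ℕ.divides 0 eq = contradiction (ℕ.m+n≡0⇒m≡0 j eq) (ℕ.>⇒≢ (ℕ.≤-<-trans z≤n i<j))
  ...   | ℕ.divides 1 eq = odd≢even (trans (sym p-odd) (trans (cong (ℕ._% 2) (sym (trans eq (ℕ.*-identityˡ p)))) sum-even))
    where
    odd≢even : ¬ (1 ≡ 0)
    odd≢even ()
    sum-even : (j ℕ.+ i) ℕ.% 2 ≡ 0
    sum-even with parity j
    ... | inj₁ e = parity-+ j i e (trans same e)
    ... | inj₂ e = parity-+ j i e (trans same e)
  ...   | ℕ.divides (suc (suc c)) eq = ℕ.<-irrefl eq (begin-strict
      j ℕ.+ i                  <⟨ ℕ.+-mono-< j<p (ℕ.<-trans i<j j<p) ⟩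
      p ℕ.+ p                  ≤⟨ ℕ.+-monoʳ-≤ p (ℕ.m≤m+n p (c ℕ.* p)) ⟩
      p ℕ.+ (p ℕ.+ c ℕ.* p)    ∎)
    where open ℕ.≤-Reasoning

  squares-not-opposite : ∀ i j → i ℕ.< j → j ℕ.< p → ¬ (+ p ∣ + i * + i + + j * + j)
  squares-not-opposite i j i<j j<p d = ∤-small j (ℕ.≤-<-trans z≤n i<j) j<p (anisotropicʳ (+ i) (+ j) d)

  signedSquare-injective : ∀ i j → i ℕ.< j → j ℕ.< p → ¬ (signedSquare i ≅ signedSquare j [ + p ])
  signedSquare-injective i j i<j j<p e with i ℕ.% 2 in i%2 | j ℕ.% 2 in j%2 | parity i | parity j
  ... | _ | _ | inj₁ refl | inj₁ refl = squares-differ i j i<j j<p (trans i%2 (sym j%2)) e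
  ... | _ | _ | inj₂ refl | inj₂ refl = squares-differ i j i<j j<p (trans i%2 (sym j%2)) (neg-injective-≅ (+ i * + i) (+ j * + j) e)
  ... | _ | _ | inj₁ refl | inj₂ refl = squares-not-opposite i j i<j j<p (δ e by opp (+ i * + i) (+ j * + j))
    where
    opp : ∀ x y → x + y ≡ x - - y
    opp = solve-∀
  ... | _ | _ | inj₂ refl | inj₁ refl = squares-not-opposite i j i<j j<p (-1ℤ ⊛ e by opp (+ i * + i) (+ j * + j))
    where
    opp : ∀ x y → x + y ≡ -1ℤ * (- x - y)
    opp = solve-∀

  residue : ℤ → Fin p
  residue z = fromℕ< (ℤ.n%ℕd<d z p)

  residue-≅ : ∀ y z → residue y ≡ residue z → y ≅ z [ + p ]
  residue-≅ y z e = ≅-trans (%ℕ-≅ y p) (≅-trans (≅-reflexive (cong +_ same)) (≅-sym (%ℕ-≅ z p)))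
    where
    same : y ℤ.%ℕ p ≡ z ℤ.%ℕ p
    same = trans (sym (toℕ-fromℕ< (ℤ.n%ℕd<d y p))) (trans (cong toℕ e) (toℕ-fromℕ< (ℤ.n%ℕd<d z p)))

  opaque
    -- Pigeonhole: z and the p values of `signedSquare` fall into p classes. The signed squares are
    -- pairwise incongruent, so z meets one of them.
    ±square : ∀ z → ∃ λ x → x * x ≅ z [ + p ] ⊎ x * x ≅ - z [ + p ]
    ±square z = collision (pigeonhole (ℕ.n<1+n p) value)
      where
      value : Fin (suc p) → Fin p
      value zero    = residue z
      value (suc i) = residue (signedSquare (toℕ i))
      unsign : ∀ n y → z ≅ signed n y [ + p ] → y ≅ z [ + p ] ⊎ y ≅ - z [ + p ]
      unsign zero    y e = inj₁ (≅-sym e)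
      unsign (suc n) y e = inj₂ (≅-trans (≅-reflexive (sym (ℤ.neg-involutive y))) (-‿cong-≅ (≅-sym e)))
      collision : (∃₂ λ i j → i Fin.< j × value i ≡ value j) → ∃ λ x → x * x ≅ z [ + p ] ⊎ x * x ≅ - z [ + p ]
      collision (zero , suc j , _ , eq) = + toℕ j , unsign (toℕ j ℕ.% 2) _ (residue-≅ z _ eq)
      collision (suc i , suc j , s<s i<j , eq) =
        ⊥-elim (signedSquare-injective (toℕ i) (toℕ j) i<j (toℕ<n j) (residue-≅ _ _ eq))

  opaque
    -- Start from the square 0 and suppose that n is a square. By `±square` either n + 1 is one too,
    -- and the walk goes on, or - (n + 1) is, and n + (- (n + 1)) = -1 is the wanted sum. The walk
    -- cannot reach p - 1, which is -1 modulo p and no square.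
    -1-as-sum-of-squares : ∃₂ λ u v → u * u + v * v ≅ -1ℤ [ + p ]
    -1-as-sum-of-squares with walk (ℕ.pred p)
      where
      walk : ∀ n → (∃ λ x → x * x ≅ + n [ + p ]) ⊎ (∃₂ λ u v → u * u + v * v ≅ -1ℤ [ + p ])
      walk zero = inj₁ (0ℤ , ≅-refl)
      walk (suc n) with walk n
      ... | inj₂ found = inj₂ found
      ... | inj₁ (u , eu) with ±square (+ suc n)
      ...   | v , inj₁ ev = inj₁ (v , ev)
      ...   | v , inj₂ ev = inj₂ (u , v , ≅-trans (+-cong-≅ eu ev) (≅-reflexive (minus-one (+ n))))
        where
        minus-one : ∀ n → n + - (1ℤ + n) ≡ -1ℤ
        minus-one = solve-∀
    ... | inj₂ found = found
    ... | inj₁ (x , e) = ⊥-elim (≢-1 x (≅-trans e (≅! (divides 1ℤ (begin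
        + ℕ.pred p - -1ℤ   ≡⟨ ℤ.+-comm (+ ℕ.pred p) 1ℤ ⟩
        + suc (ℕ.pred p)   ≡⟨ cong +_ (ℕ.suc-pred p) ⟩
        + p                ≡⟨ sym (ℤ.*-identityˡ (+ p)) ⟩
        1ℤ * + p           ∎)))))
      where open ≡-Reasoning

  opaque
    -- One Newton step: with x² - z = e p, the correction t = - e / (2 x) modulo p kills the term of
    -- order p.
    hensel : ∀ x z → Coprime x (+ p) → x * x ≅ z [ + p ] → ∃ λ y → y * y ≅ z [ + p * + p ]
    hensel x z c (≅! (divides e eq)) with inverse (coprime-* 2-coprime c)
    ... | i , ≅! (divides g eg) = x + t * + p , ≅! (divides (t * t - e * g) (begin
        (x + t * + p) * (x + t * + p) - z                           ≡⟨ expand x t (+ p) z ⟩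
        (x * x - z) + (+ 2 * x * t) * + p + t * t * (+ p * + p)     ≡⟨ cong (λ w → w + (+ 2 * x * t) * + p + t * t * (+ p * + p)) eq ⟩
        e * + p + (+ 2 * x * t) * + p + t * t * (+ p * + p)         ≡⟨ regroup x e i (+ p) ⟩
        t * t * (+ p * + p) - e * (+ 2 * x * i - 1ℤ) * + p          ≡⟨ cong (λ w → t * t * (+ p * + p) - e * w * + p) eg ⟩
        t * t * (+ p * + p) - e * (g * + p) * + p                   ≡⟨ collect t e g (+ p) ⟩
        (t * t - e * g) * (+ p * + p)                               ∎))
      where
      open ≡-Reasoning
      t : ℤ
      t = - (e * i)
      expand : ∀ x t p z → (x + t * p) * (x + t * p) - z ≡ (x * x - z) + (+ 2 * x * t) * p + t * t * (p * p)
      expand = solve-∀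
      regroup : ∀ x e i p → let t = - (e * i) in
        e * p + (+ 2 * x * t) * p + t * t * (p * p) ≡ t * t * (p * p) - e * (+ 2 * x * i - 1ℤ) * p
      regroup = solve-∀
      collect : ∀ t e g p → t * t * (p * p) - e * (g * p) * p ≡ (t * t - e * g) * (p * p)
      collect = solve-∀

  root-unit : ∀ x z → Coprime z (+ p) → x * x ≅ z [ + p ] → Coprime x (+ p)
  root-unit x z c e = prime∤⇒coprime pp λ p∣x → ¬∣-coprime pp c (∣-≅ (≅-sym e) (∣n⇒∣m*n x p∣x))

  ±square² : ∀ z → Coprime z (+ p) → ∃ λ x → x * x ≅ z [ + p * + p ] ⊎ x * x ≅ - z [ + p * + p ]
  ±square² z c = lift (±square z)
    where
    lift : (∃ λ x → x * x ≅ z [ + p ] ⊎ x * x ≅ - z [ + p ]) → ∃ λ x → x * x ≅ z [ + p * + p ] ⊎ x * x ≅ - z [ + p * + p ]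
    lift (x , inj₁ e) = let y , e' = hensel x z (root-unit x z c e) e in y , inj₁ e'
    lift (x , inj₂ e) = let y , e' = hensel x (- z) (root-unit x (- z) (coprime-neg c) e) e in y , inj₂ e'

  -- It suffices to lift one coordinate: u is a unit, as otherwise v² ≡ -1 (mod p), so u lifts to a
  -- root of -1 - v² modulo p².
  -1-as-sum-of-squares² : ∃₂ λ u v → u * u + v * v ≅ -1ℤ [ + p * + p ]
  -1-as-sum-of-squares² =
    let u , v , e = -1-as-sum-of-squares
        y , e' = hensel u (-1ℤ - v * v) (prime∤⇒coprime pp λ p∣u → ≢-1 v (drop-square u v e p∣u)) (transpose-square u v e)
    in y , v , transpose-square⁻ y v e'

  -- If it is - z that is a square x², scaling a representation of -1 by x gives one of z.
  sum-of-squares² : ∀ z → Coprime z (+ p) → ∃₂ λ u v → u * u + v * v ≅ z [ + p * + p ]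
  sum-of-squares² z c = represent (±square² z c)
    where
    represent : (∃ λ x → x * x ≅ z [ + p * + p ] ⊎ x * x ≅ - z [ + p * + p ]) → ∃₂ λ u v → u * u + v * v ≅ z [ + p * + p ]
    represent (x , inj₁ e) = x , 0ℤ , ≅-trans (≅-reflexive (ℤ.+-identityʳ (x * x))) e
    represent (x , inj₂ e) =
      let u , v , e' = -1-as-sum-of-squares² in u * x , v * x , neg-square-norm u v x z e' e

-- Shears of a pair of vectors

-- Completing the square in |p A + q C|², where N = |A|², s = A·C, T = |C|², D = det(A, C), and the
-- first hypothesis is Lagrange's identity.
scaled-form : ∀ N s T D p q X Y {n} → N * T ≡ s * s + D * D →
  N * p + s * q ≅ X [ n ] → D * q ≅ Y [ n ] →
  N * (+ 2 * (N * p * p + + 2 * s * p * q + T * q * q)) ≅ + 2 * (X * X + Y * Y) [ n ]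
scaled-form N s T D p q X Y NT e₁ e₂ = ≅!
  ((+ 2 * (N * p + s * q + X)) ⊛ e₁ ⊕ (+ 2 * (D * q + Y)) ⊛ e₂ ⊕ (+ 2 * q * q) ⊛ ≅-reflexive NT
   by solve (N ∷ s ∷ T ∷ D ∷ p ∷ q ∷ X ∷ Y ∷ []))

-- With f = 1/4 and ι² = -1 the two squares are (U + 2)² / 16 and - (U - 2)² / 16, with sum U / 2:
-- the norm form is a hyperbolic plane modulo n.
difference-of-squares : ∀ U ι f {n} → ι * ι ≅ -1ℤ [ n ] → + 4 * f ≅ 1ℤ [ n ] →
  + 2 * ((U + + 2) * f * ((U + + 2) * f) + - (ι * ((U - + 2) * f)) * - (ι * ((U - + 2) * f))) ≅ U [ n ]
difference-of-squares U ι f e₁ e₂ = ≅!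
  ((+ 2 * ((U - + 2) * f) * ((U - + 2) * f)) ⊛ e₁ ⊕ (U * (+ 4 * f + 1ℤ)) ⊛ e₂
   by solve (U ∷ ι ∷ f ∷ []))

solve-p : ∀ N N' s q X {n} → N * N' ≅ 1ℤ [ n ] → N * (N' * (X - s * q)) + s * q ≅ X [ n ]
solve-p N N' s q X e = ≅! ((X - s * q) ⊛ e by solve (N ∷ N' ∷ s ∷ q ∷ X ∷ []))

unit-* : ∀ D D' Y {n} → D * D' ≅ 1ℤ [ n ] → D * (D' * Y) ≅ Y [ n ]
unit-* D D' Y e = ≅! (Y ⊛ e by solve (D ∷ D' ∷ Y ∷ []))

-- A matrix with rows (p, q), (p', q'), determinant 1 and p' invertible is a product of three
-- elementary matrices with parameters ξ = (p - 1) / p', η = p', ζ = (q' - 1) / p'. This entry is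
-- the one that uses the determinant.
shear-entry₁₂ : ∀ p q p' q' i {n} → p * q' - q * p' ≅ 1ℤ [ n ] → p' * i ≅ 1ℤ [ n ] →
  (p - 1ℤ) * i + (q' - 1ℤ) * i + (p - 1ℤ) * i * p' * ((q' - 1ℤ) * i) ≅ q [ n ]
shear-entry₁₂ p q p' q' i e₁ e₂ = ≅!
  (i ⊛ e₁ ⊕ (q + (q' - 1ℤ) * i * (p - 1ℤ)) ⊛ e₂ by solve (p ∷ q ∷ p' ∷ q' ∷ i ∷ []))

shear-entry₁₁ : ∀ x p' i {n} → p' * i ≅ 1ℤ [ n ] → 1ℤ + (x - 1ℤ) * i * p' ≅ x [ n ]
shear-entry₁₁ x p' i e = ≅! ((x - 1ℤ) ⊛ e by solve (x ∷ p' ∷ i ∷ []))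

shear-entry₂₂ : ∀ x p' i {n} → p' * i ≅ 1ℤ [ n ] → 1ℤ + p' * ((x - 1ℤ) * i) ≅ x [ n ]
shear-entry₂₂ x p' i e = ≅! ((x - 1ℤ) ⊛ e by solve (x ∷ p' ∷ i ∷ []))

coordinates₁ : ∀ a₁ a₂ c₁ c₂ D' v₁ v₂ {n} → (a₁ * c₂ - a₂ * c₁) * D' ≅ 1ℤ [ n ] →
  (v₁ * c₂ - v₂ * c₁) * D' * a₁ + (a₁ * v₂ - a₂ * v₁) * D' * c₁ ≅ v₁ [ n ]
coordinates₁ a₁ a₂ c₁ c₂ D' v₁ v₂ e = ≅! (v₁ ⊛ e by solve (a₁ ∷ a₂ ∷ c₁ ∷ c₂ ∷ D' ∷ v₁ ∷ v₂ ∷ []))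

coordinates₂ : ∀ a₁ a₂ c₁ c₂ D' v₁ v₂ {n} → (a₁ * c₂ - a₂ * c₁) * D' ≅ 1ℤ [ n ] →
  (v₁ * c₂ - v₂ * c₁) * D' * a₂ + (a₁ * v₂ - a₂ * v₁) * D' * c₂ ≅ v₂ [ n ]
coordinates₂ a₁ a₂ c₁ c₂ D' v₁ v₂ e = ≅! (v₂ ⊛ e by solve (a₁ ∷ a₂ ∷ c₁ ∷ c₂ ∷ D' ∷ v₁ ∷ v₂ ∷ []))

-- A change of basis preserving the determinant has a coordinate matrix of determinant 1, as the
-- shear factorisation requires.
coordinates-det : ∀ a₁ a₂ c₁ c₂ D' v₁ v₂ w₁ w₂ {n} → (a₁ * c₂ - a₂ * c₁) * D' ≅ 1ℤ [ n ] →
  v₁ * w₂ - v₂ * w₁ ≅ a₁ * c₂ - a₂ * c₁ [ n ] →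
  (v₁ * c₂ - v₂ * c₁) * D' * ((a₁ * w₂ - a₂ * w₁) * D') - (a₁ * v₂ - a₂ * v₁) * D' * ((w₁ * c₂ - w₂ * c₁) * D') ≅ 1ℤ [ n ]
coordinates-det a₁ a₂ c₁ c₂ D' v₁ v₂ w₁ w₂ e₁ e₂ = ≅!
  ((D' * D' * (a₁ * c₂ - a₂ * c₁)) ⊛ e₂ ⊕ ((a₁ * c₂ - a₂ * c₁) * D' + 1ℤ) ⊛ e₁
   by solve (a₁ ∷ a₂ ∷ c₁ ∷ c₂ ∷ D' ∷ v₁ ∷ v₂ ∷ w₁ ∷ w₂ ∷ []))

-- First row of the product of an upper, a lower and an upper elementary matrix with parameters ξ,
-- η, ζ, applied to (A, C); `shearC` is the second row. The product has determinant 1 over ℤ for all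
-- parameters, so these can be prescribed by congruences while det(A, C) stays exactly fixed.
shearA : (ξ η ζ a c : ℤ) → ℤ
shearA ξ η ζ a c = (1ℤ + ξ * η) * a + (ξ + ζ + ξ * η * ζ) * c

shearC : (η ζ a c : ℤ) → ℤ
shearC η ζ a c = η * a + (1ℤ + η * ζ) * c

shear-det : ∀ a₁ a₂ c₁ c₂ ξ η ζ →
  ((1ℤ + ξ * η) * a₁ + (ξ + ζ + ξ * η * ζ) * c₁) * (η * a₂ + (1ℤ + η * ζ) * c₂)
   - ((1ℤ + ξ * η) * a₂ + (ξ + ζ + ξ * η * ζ) * c₂) * (η * a₁ + (1ℤ + η * ζ) * c₁)
  ≡ a₁ * c₂ - a₂ * c₁
shear-det = solve-∀

shearA-cong : ∀ {ξ ξ' η η' ζ ζ' n} a c → ξ ≅ ξ' [ n ] → η ≅ η' [ n ] → ζ ≅ ζ' [ n ] →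
  shearA ξ η ζ a c ≅ shearA ξ' η' ζ' a c [ n ]
shearA-cong a c x y z =
  +-cong-≅ (*-cong-≅ (+-cong-≅ (≅-refl {a = 1ℤ}) (*-cong-≅ x y)) (≅-refl {a = a}))
           (*-cong-≅ (+-cong-≅ (+-cong-≅ x z) (*-cong-≅ (*-cong-≅ x y) z)) (≅-refl {a = c}))

shearC-cong : ∀ {η η' ζ ζ' n} a c → η ≅ η' [ n ] → ζ ≅ ζ' [ n ] →
  shearC η ζ a c ≅ shearC η' ζ' a c [ n ]
shearC-cong a c y z =
  +-cong-≅ (*-cong-≅ y (≅-refl {a = a})) (*-cong-≅ (+-cong-≅ (≅-refl {a = 1ℤ}) (*-cong-≅ y z)) (≅-refl {a = c}))

-- Multiplied by d, the numerator of P involves C only through β = d C. When l ≡ 0 and m d ≡ - k it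
-- becomes the numerator in Cramer's rule for the pair A, B = d C.
numerator-mod : ∀ h k N N' d c β T T' l m a α s {n} → N ≅ N' [ n ] → d * c ≅ β [ n ] → d * (d * T) ≅ T' [ n ] →
  l ≅ 0ℤ [ n ] → m * d ≅ - k [ n ] → a ≅ α [ n ] →
  d * (- (h + N) * c + (m + + 2 * l * s + d * T) * a) ≅ - (h + N') * β + (T' - k) * α [ n ]
numerator-mod h k N N' d c β T T' l m a α s hN hc hT hl hm ha = ≅!
  ((- (h + N)) ⊛ hc ⊕ (- β) ⊛ hN ⊕ a ⊛ hm ⊕ (a * (+ 2 * d * s)) ⊛ hl ⊕ a ⊛ hT ⊕ (T' - k) ⊛ ha
   by solve (h ∷ k ∷ N ∷ N' ∷ d ∷ c ∷ β ∷ T ∷ T' ∷ l ∷ m ∷ a ∷ α ∷ s ∷ []))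

-- Elimination of p₂ from the two equations, which are linear in P; `cramer₂` eliminates p₁.
cramer₁ : ∀ h k p₁ p₂ a₁ a₂ b₁ b₂ {n} →
  a₁ * a₁ + a₂ * a₂ + + 2 * (a₁ * p₁ + a₂ * p₂) ≅ - h [ n ] →
  b₁ * b₁ + b₂ * b₂ + + 2 * (b₁ * p₁ + b₂ * p₂) ≅ k [ n ] →
  - (h + (a₁ * a₁ + a₂ * a₂)) * b₂ + ((b₁ * b₁ + b₂ * b₂) - k) * a₂ ≅ + 2 * (a₁ * b₂ - a₂ * b₁) * p₁ [ n ]
cramer₁ h k p₁ p₂ a₁ a₂ b₁ b₂ e₁ e₂ = ≅!
  ((- b₂) ⊛ e₁ ⊕ a₂ ⊛ e₂ by solve (h ∷ k ∷ p₁ ∷ p₂ ∷ a₁ ∷ a₂ ∷ b₁ ∷ b₂ ∷ []))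

cramer₂ : ∀ h k p₁ p₂ a₁ a₂ b₁ b₂ {n} →
  a₁ * a₁ + a₂ * a₂ + + 2 * (a₁ * p₁ + a₂ * p₂) ≅ - h [ n ] →
  b₁ * b₁ + b₂ * b₂ + + 2 * (b₁ * p₁ + b₂ * p₂) ≅ k [ n ] →
  - (h + (a₁ * a₁ + a₂ * a₂)) * b₁ + ((b₁ * b₁ + b₂ * b₂) - k) * a₁ ≅ + 2 * (a₁ * b₂ - a₂ * b₁) * - p₂ [ n ]
cramer₂ h k p₁ p₂ a₁ a₂ b₁ b₂ e₁ e₂ = ≅!
  ((- b₁) ⊛ e₁ ⊕ a₁ ⊛ e₂ by solve (h ∷ k ∷ p₁ ∷ p₂ ∷ a₁ ∷ a₂ ∷ b₁ ∷ b₂ ∷ []))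

nrm : ℤ → ℤ → ℤ
nrm x y = x * x + y * y

nrm-cong : ∀ {x x' y y' n} → x ≅ x' [ n ] → y ≅ y' [ n ] → nrm x y ≅ nrm x' y' [ n ]
nrm-cong p q = +-cong-≅ (*-cong-≅ p p) (*-cong-≅ q q)

linComb-cong : ∀ {p p' q q' n} a c → p ≅ p' [ n ] → q ≅ q' [ n ] → p * a + q * c ≅ p' * a + q' * c [ n ]
linComb-cong a c e e' = +-cong-≅ (*-cong-≅ e (≅-refl {a = a})) (*-cong-≅ e' (≅-refl {a = c}))

coprime-inverse : ∀ a {b n} → a * b ≅ 1ℤ [ n ] → Coprime b n
coprime-inverse a {b} e = unit⇒coprime {b = a} (≅-trans (≅-reflexive (ℤ.*-comm b a)) e)

sqrt-1-unit : ∀ ι {n} → ι * ι ≅ -1ℤ [ n ] → ι * - ι ≅ 1ℤ [ n ]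
sqrt-1-unit ι e = ≅! (-1ℤ ⊛ e by solve (ι ∷ []))

nrm-expand : ∀ a₁ a₂ c₁ c₂ p q → let N = a₁ * a₁ + a₂ * a₂; s = a₁ * c₁ + a₂ * c₂; T = c₁ * c₁ + c₂ * c₂ in
  (p * a₁ + q * c₁) * (p * a₁ + q * c₁) + (p * a₂ + q * c₂) * (p * a₂ + q * c₂) ≡ N * p * p + + 2 * s * p * q + T * q * q
nrm-expand = solve-∀

lagrange : ∀ a₁ a₂ c₁ c₂ → (a₁ * a₁ + a₂ * a₂) * (c₁ * c₁ + c₂ * c₂) ≡
  (a₁ * c₁ + a₂ * c₂) * (a₁ * c₁ + a₂ * c₂) + (a₁ * c₂ - a₂ * c₁) * (a₁ * c₂ - a₂ * c₁)
lagrange = solve-∀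

-- For A' = p A + q C, completing the square turns 2 N |A'|² into 2 (X² + Y²) with X = N p + s q and
-- Y = D q; the hyperbolic parametrisation of U = N V supplies X and Y. Two shears reach A' once q
-- is a unit, and q is a unit multiple of N V - 2.
shear-to-norm : ∀ a₁ a₂ c₁ c₂ V ι {n} → let N = nrm a₁ a₂; D = a₁ * c₂ - a₂ * c₁ in
  ι * ι ≅ -1ℤ [ n ] → Coprime (+ 4) n → Coprime N n → Coprime D n → Coprime (N * V - + 2) n →
  ∃₂ λ ξ η → + 2 * nrm (shearA ξ η 0ℤ a₁ c₁) (shearA ξ η 0ℤ a₂ c₂) ≅ V [ n ]
shear-to-norm a₁ a₂ c₁ c₂ V ι {n} hι h4 hN hD hW
  with inverse h4 | inverse hN | inverse hD
... | f , hf | N' , hN' | D' , hD' = q , η , value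
  where
  N = nrm a₁ a₂
  D = a₁ * c₂ - a₂ * c₁
  s = a₁ * c₁ + a₂ * c₂
  X = (N * V + + 2) * f
  Y = - (ι * ((N * V - + 2) * f))
  q = D' * Y
  p = N' * (X - s * q)

  q-unit : Coprime q n
  q-unit = coprime-* (coprime-inverse (a₁ * c₂ - a₂ * c₁) hD')
    (coprime-neg (coprime-* (unit⇒coprime {ι} { - ι} (sqrt-1-unit ι hι)) (coprime-* hW (coprime-inverse (+ 4) hf))))

  q' = proj₁ (inverse q-unit)
  η = (p - 1ℤ) * q'

  coordA : 1ℤ + q * η ≅ p [ n ]
  coordA = shear-entry₂₂ p q q' (proj₂ (inverse q-unit))

  coordC : q + 0ℤ + q * η * 0ℤ ≡ q
  coordC = drop q η
    where
    drop : ∀ q η → q + 0ℤ + q * η * 0ℤ ≡ q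
    drop = solve-∀

  norm : N * (+ 2 * nrm (p * a₁ + q * c₁) (p * a₂ + q * c₂)) ≅ N * V [ n ]
  norm = ≅-trans (≅-reflexive (cong (λ z → N * (+ 2 * z)) (nrm-expand a₁ a₂ c₁ c₂ p q)))
        (≅-trans (scaled-form N s (nrm c₁ c₂) D p q X Y (lagrange a₁ a₂ c₁ c₂)
                    (solve-p N N' s q X hN') (unit-* D D' Y hD'))
                 (difference-of-squares (N * V) ι f hι hf))

  value : + 2 * nrm (shearA q η 0ℤ a₁ c₁) (shearA q η 0ℤ a₂ c₂) ≅ V [ n ]
  value = ≅-trans
    (*-cong-≅ (≅-refl {a = + 2}) (nrm-cong (linComb-cong a₁ c₁ coordA (≅-reflexive coordC))
                                           (linComb-cong a₂ c₂ coordA (≅-reflexive coordC))))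
    (coprime-cancel hN norm)

-- Expand α and β / d in the basis A, C modulo n. The condition on D d gives the coordinate matrix
-- determinant 1, and its lower left entry is a unit because det(β, C) is; so it factors into three
-- shears.
shear-to-pair : ∀ a₁ a₂ c₁ c₂ d α₁ α₂ β₁ β₂ {n} → let D = a₁ * c₂ - a₂ * c₁ in
  Coprime D n → Coprime d n → Coprime (β₁ * c₂ - β₂ * c₁) n → D * d ≅ α₁ * β₂ - α₂ * β₁ [ n ] →
  ∃₂ λ ξ η → ∃ λ ζ → (shearA ξ η ζ a₁ c₁ ≅ α₁ [ n ] × shearA ξ η ζ a₂ c₂ ≅ α₂ [ n ]) ×
    (d * shearC η ζ a₁ c₁ ≅ β₁ [ n ] × d * shearC η ζ a₂ c₂ ≅ β₂ [ n ])
shear-to-pair a₁ a₂ c₁ c₂ d α₁ α₂ β₁ β₂ {n} hD hd hβ hdet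
  with inverse hD | inverse hd
... | D' , hD' | d' , hd' =
  (p - 1ℤ) * i , p' , (q' - 1ℤ) * i
  , (≅-trans (linComb-cong a₁ c₁ (shear-entry₁₁ p p' i hi) (shear-entry₁₂ p q p' q' i hpq hi)) (coordinates₁ a₁ a₂ c₁ c₂ D' α₁ α₂ hD')
    , ≅-trans (linComb-cong a₂ c₂ (shear-entry₁₁ p p' i hi) (shear-entry₁₂ p q p' q' i hpq hi)) (coordinates₂ a₁ a₂ c₁ c₂ D' α₁ α₂ hD'))
  , (rescale (≅-trans (linComb-cong a₁ c₁ (≅-refl {a = p'}) (shear-entry₂₂ q' p' i hi)) (coordinates₁ a₁ a₂ c₁ c₂ D' γ₁ γ₂ hD'))
    , rescale (≅-trans (linComb-cong a₂ c₂ (≅-refl {a = p'}) (shear-entry₂₂ q' p' i hi)) (coordinates₂ a₁ a₂ c₁ c₂ D' γ₁ γ₂ hD')))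
  where
  γ₁ = d' * β₁
  γ₂ = d' * β₂
  p = (α₁ * c₂ - α₂ * c₁) * D'
  q = (a₁ * α₂ - a₂ * α₁) * D'
  p' = (γ₁ * c₂ - γ₂ * c₁) * D'
  q' = (a₁ * γ₂ - a₂ * γ₁) * D'

  factor : ∀ d' β₁ β₂ c₁ c₂ → d' * β₁ * c₂ - d' * β₂ * c₁ ≡ d' * (β₁ * c₂ - β₂ * c₁)
  factor = solve-∀

  p'-unit : Coprime p' n
  p'-unit = coprime-* (coprime-≅ (≅-reflexive (factor d' β₁ β₂ c₁ c₂)) (coprime-* (coprime-inverse d hd') hβ)) (coprime-inverse (a₁ * c₂ - a₂ * c₁) hD')

  i = proj₁ (inverse p'-unit)
  hi = proj₂ (inverse p'-unit)

  det-γ : ∀ d d' D α₁ α₂ β₁ β₂ → d * d' ≅ 1ℤ [ n ] → D * d ≅ α₁ * β₂ - α₂ * β₁ [ n ] → α₁ * (d' * β₂) - α₂ * (d' * β₁) ≅ D [ n ]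
  det-γ d d' D α₁ α₂ β₁ β₂ e₁ e₂ = ≅! (- d' ⊛ e₂ ⊕ D ⊛ e₁ by solve (d ∷ d' ∷ D ∷ α₁ ∷ α₂ ∷ β₁ ∷ β₂ ∷ []))

  hpq : p * q' - q * p' ≅ 1ℤ [ n ]
  hpq = coordinates-det a₁ a₂ c₁ c₂ D' α₁ α₂ γ₁ γ₂ hD' (det-γ d d' (a₁ * c₂ - a₂ * c₁) α₁ α₂ β₁ β₂ hd' hdet)

  rescale : ∀ {x β} → x ≅ d' * β [ n ] → d * x ≅ β [ n ]
  rescale {x} {β} e = ≅-trans (*-cong-≅ (≅-refl {a = d}) e) (unit-* d d' β hd')

-- Exact solutions of the two norm equations

module _ (a₁ a₂ c₁ c₂ h k l d m p₁ p₂ : ℤ) where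
  private
    D = a₁ * c₂ - a₂ * c₁
    N = a₁ * a₁ + a₂ * a₂
    κ = m + + 2 * l * (a₁ * c₁ + a₂ * c₂) + d * (c₁ * c₁ + c₂ * c₂)

  -- The terms with `κ` cancel in A·P, so this equation holds whatever the value of `κ`.
  family₁ : D ≢ 0ℤ → + 2 * D * p₁ ≡ - (h + N) * c₂ + κ * a₂ → + 2 * D * - p₂ ≡ - (h + N) * c₁ + κ * a₁ →
    N + + 2 * (a₁ * p₁ + a₂ * p₂) ≡ - h
  family₁ D≢0 e₁ e₂ = ℤ.*-cancelˡ-≡ D _ _ {{≢-nonZero D≢0}} (begin
    D * (N + + 2 * (a₁ * p₁ + a₂ * p₂))                     ≡⟨ split a₁ a₂ D N p₁ p₂ ⟩
    D * N + a₁ * (+ 2 * D * p₁) - a₂ * (+ 2 * D * - p₂)     ≡⟨ cong₂ (λ x y → D * N + a₁ * x - a₂ * y) e₁ e₂ ⟩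
    D * N + a₁ * (- (h + N) * c₂ + κ * a₂) - a₂ * (- (h + N) * c₁ + κ * a₁) ≡⟨ collect a₁ a₂ c₁ c₂ h N κ ⟩
    D * - h ∎)
    where
    open ≡-Reasoning
    split : ∀ a₁ a₂ D N p₁ p₂ → D * (N + + 2 * (a₁ * p₁ + a₂ * p₂)) ≡ D * N + a₁ * (+ 2 * D * p₁) - a₂ * (+ 2 * D * - p₂)
    split = solve-∀
    collect : ∀ a₁ a₂ c₁ c₂ h N κ → (a₁ * c₂ - a₂ * c₁) * N + a₁ * (- (h + N) * c₂ + κ * a₂) - a₂ * (- (h + N) * c₁ + κ * a₁) ≡ (a₁ * c₂ - a₂ * c₁) * - h
    collect = solve-∀

  -- The form of `κ` makes D times the left side collapse to D (N l² - (N + h) l - m d), which the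
  -- equation for m d turns into D k.
  family₂ : D ≢ 0ℤ → + 2 * D * p₁ ≡ - (h + N) * c₂ + κ * a₂ → + 2 * D * - p₂ ≡ - (h + N) * c₁ + κ * a₁ →
    m * d ≡ N * l * l - (N + h) * l - k → let b₁ = l * a₁ + d * c₁; b₂ = l * a₂ + d * c₂ in
    b₁ * b₁ + b₂ * b₂ + + 2 * (b₁ * p₁ + b₂ * p₂) ≡ k
  family₂ D≢0 e₁ e₂ e₃ = ℤ.*-cancelˡ-≡ D _ _ {{≢-nonZero D≢0}} (begin
    D * (b₁ * b₁ + b₂ * b₂ + + 2 * (b₁ * p₁ + b₂ * p₂))                     ≡⟨ split b₁ b₂ D p₁ p₂ ⟩
    D * (b₁ * b₁ + b₂ * b₂) + b₁ * (+ 2 * D * p₁) - b₂ * (+ 2 * D * - p₂)     ≡⟨ cong₂ (λ x y → D * (b₁ * b₁ + b₂ * b₂) + b₁ * x - b₂ * y) e₁ e₂ ⟩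
    D * (b₁ * b₁ + b₂ * b₂) + b₁ * (- (h + N) * c₂ + κ * a₂) - b₂ * (- (h + N) * c₁ + κ * a₁) ≡⟨ collect a₁ a₂ c₁ c₂ h l d m ⟩
    D * (N * l * l - (N + h) * l - m * d) ≡⟨ cong (λ z → D * (N * l * l - (N + h) * l - z)) e₃ ⟩
    D * (N * l * l - (N + h) * l - (N * l * l - (N + h) * l - k)) ≡⟨ finish D N l h k ⟩
    D * k ∎)
    where
    open ≡-Reasoning
    b₁ = l * a₁ + d * c₁
    b₂ = l * a₂ + d * c₂
    split : ∀ b₁ b₂ D p₁ p₂ → D * (b₁ * b₁ + b₂ * b₂ + + 2 * (b₁ * p₁ + b₂ * p₂)) ≡ D * (b₁ * b₁ + b₂ * b₂) + b₁ * (+ 2 * D * p₁) - b₂ * (+ 2 * D * - p₂)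
    split = solve-∀
    finish : ∀ D N l h k → D * (N * l * l - (N + h) * l - (N * l * l - (N + h) * l - k)) ≡ D * k
    finish = solve-∀
    collect : ∀ a₁ a₂ c₁ c₂ h l d m → let D = a₁ * c₂ - a₂ * c₁; N = a₁ * a₁ + a₂ * a₂; κ = m + + 2 * l * (a₁ * c₁ + a₂ * c₂) + d * (c₁ * c₁ + c₂ * c₂); b₁ = l * a₁ + d * c₁; b₂ = l * a₂ + d * c₂ in
      D * (b₁ * b₁ + b₂ * b₂) + b₁ * (- (h + N) * c₂ + κ * a₂) - b₂ * (- (h + N) * c₁ + κ * a₁) ≡ D * (N * l * l - (N + h) * l - m * d)
    collect = solve-∀

-- Deforming a configuration

crt₃ : ∀ {l m n} → Coprime l m → Coprime l n → Coprime m n → ∀ a b c →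
  ∃ λ x → x ≅ a [ l ] × x ≅ b [ m ] × x ≅ c [ n ]
crt₃ {l} {m} {n} lm ln mn a b c with crt mn b c
... | y , y≅b , y≅c with crt (coprime-sym (coprime-* (coprime-sym lm) (coprime-sym ln))) a y
... | x , x≅a , x≅y = x , x≅a
  , ≅-trans (≅-weaken (∣m⇒∣m*n n ∣-refl) x≅y) y≅b
  , ≅-trans (≅-weaken (∣n⇒∣m*n m ∣-refl) x≅y) y≅c

sqrt-1 : ∀ x w w' → w * w' ≅ 1ℤ [ x * x + w * w ] → x * w' * (x * w') ≅ -1ℤ [ x * x + w * w ]
sqrt-1 x w w' e = ≅!
  (∣n⇒∣m*n (w' * w') (∣-refl {x * x + w * w}) ⊕ (- (w * w' + 1ℤ)) ⊛ e by solve (x ∷ w ∷ w' ∷ []))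

sum-of-squares-≅ : ∀ x y w {n} → x ≅ y [ n ] → n ∣ w → x * x + w * w ≅ y * y [ n ]
sum-of-squares-≅ x y w e n∣w = ≅! ((x + y) ⊛ e ⊕ ∣n⇒∣m*n w n∣w by solve (x ∷ y ∷ w ∷ []))

-- At l = 2 the quadratic equals 2 N - (k + 2 h), which explains the norm prescribed for A modulo d.
quadratic-at-2 : ∀ N l h k {n} → l ≅ + 2 [ n ] → + 2 * N ≅ k + + 2 * h [ n ] → n ∣ N * l * l - (N + h) * l - k
quadratic-at-2 N l h k e₁ e₂ = (N * (l + + 2) - (N + h)) ⊛ e₁ ⊕ δ e₂ by solve (N ∷ l ∷ h ∷ k ∷ [])

quadratic-at-0 : ∀ N l h k {n} → l ≅ 0ℤ [ n ] → N * l * l - (N + h) * l - k ≅ - k [ n ]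
quadratic-at-0 N l h k e = ≅! ((N * l - (N + h)) ⊛ e by solve (N ∷ l ∷ h ∷ k ∷ []))

1-* : ∀ d x y {n} → d ≅ 1ℤ [ n ] → x ≅ y [ n ] → d * x ≅ y [ n ]
1-* d x y e₁ e₂ = ≅! (x ⊛ e₁ ⊕ δ e₂ by solve (d ∷ x ∷ y ∷ []))

1-*-cancel : ∀ d x y {n} → d ≅ 1ℤ [ n ] → d * x ≅ y [ n ] → x ≅ y [ n ]
1-*-cancel d x y e₁ e₂ = ≅! ((- x) ⊛ e₁ ⊕ δ e₂ by solve (d ∷ x ∷ y ∷ []))

-- A congruence modulo a multiple of D upgrades to exact divisibility by D, and the rest of the
-- modulus controls the quotient.
exact-lift : ∀ D p X K E → X ≅ D * p [ K * E * D ] → ∃ λ p' → D * p' ≡ X × p' ≅ p [ K ]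
exact-lift D p X K E (≅! (divides t e)) = p + t * (K * E) , exact , ≅! (divides (t * E) (multiple p t K E))
  where
  open ≡-Reasoning
  expand : ∀ D p t K E → D * (p + t * (K * E)) ≡ D * p + t * (K * E * D)
  expand = solve-∀
  multiple : ∀ p t K E → p + t * (K * E) - p ≡ t * E * K
  multiple = solve-∀
  restore : ∀ X Y → Y + (X - Y) ≡ X
  restore = solve-∀
  exact : D * (p + t * (K * E)) ≡ X
  exact = begin
    D * (p + t * (K * E))    ≡⟨ expand D p t K E ⟩
    D * p + t * (K * E * D)  ≡⟨ cong (λ z → D * p + z) (sym e) ⟩
    D * p + (X - D * p)      ≡⟨ restore X (D * p) ⟩
    X ∎

rescale-mod : ∀ d D p u e {n} → d * (+ 2 * D * p) ≅ + 2 * e * u [ n ] → D * d ≅ e [ n ] →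
  + 2 * (D * d) * p ≅ + 2 * (D * d) * u [ n ]
rescale-mod d D p u e h₁ h₂ = ≅! (δ h₁ ⊕ (- (+ 2 * u)) ⊛ h₂ by solve (d ∷ D ∷ p ∷ u ∷ e ∷ []))

square-scale : ∀ d x y x' y' {n} → d * x ≅ x' [ n ] → d * y ≅ y' [ n ] → d * (d * (x * x + y * y)) ≅ x' * x' + y' * y' [ n ]
square-scale d x y x' y' e₁ e₂ = ≅! ((d * x + x') ⊛ e₁ ⊕ (d * y + y') ⊛ e₂ by solve (d ∷ x ∷ y ∷ x' ∷ y' ∷ []))

record Config (h k : ℤ) : Set where
  field
    p₁ p₂ a₁ a₂ b₁ b₂ : ℤ
    eqA : a₁ * a₁ + a₂ * a₂ + + 2 * (a₁ * p₁ + a₂ * p₂) ≡ - h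
    eqB : b₁ * b₁ + b₂ * b₂ + + 2 * (b₁ * p₁ + b₂ * p₂) ≡ k
    det≢0 : a₁ * b₂ - a₂ * b₁ ≢ 0ℤ

record _≃_[_] {h k : ℤ} (c c' : Config h k) (n : ℤ) : Set where
  private
    module X = Config c
    module Y = Config c'
  field
    p₁≅ : X.p₁ ≅ Y.p₁ [ n ]
    p₂≅ : X.p₂ ≅ Y.p₂ [ n ]
    a₁≅ : X.a₁ ≅ Y.a₁ [ n ]
    a₂≅ : X.a₂ ≅ Y.a₂ [ n ]
    b₁≅ : X.b₁ ≅ Y.b₁ [ n ]
    b₂≅ : X.b₂ ≅ Y.b₂ [ n ]

-- A target for the deformation modulo n. Since det(A, C) = D is kept while B ≡ d C, the target
-- determinant has to be D d; d will be congruent to x², whence the field `det`. With (c₁, c₂) the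
-- old B, `b-unit` provides the pivot of the shear factorisation.
record LocalConfig (h k D c₁ c₂ n : ℤ) : Set where
  field
    p₁ p₂ a₁ a₂ b₁ b₂ x : ℤ
    eqA : a₁ * a₁ + a₂ * a₂ + + 2 * (a₁ * p₁ + a₂ * p₂) ≅ - h [ n ]
    eqB : b₁ * b₁ + b₂ * b₂ + + 2 * (b₁ * p₁ + b₂ * p₂) ≅ k [ n ]
    det : D * (x * x) ≅ a₁ * b₂ - a₂ * b₁ [ n ]
    x-unit : Coprime x n
    b-unit : Coprime (b₁ * c₂ - b₂ * c₁) n

-- Collects what must be invertible modulo d in shear-to-norm, apart from det c.
auxFactor : ∀ {h k} → Config h k → ℤ
auxFactor {h} {k} c = + 2 * (nrm a₁ a₂ * (nrm a₁ a₂ * (k + + 2 * h) - + 2))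
  where open Config c

det : ∀ {h k} → Config h k → ℤ
det c = a₁ * b₂ - a₂ * b₁
  where open Config c

record SplitModulus (L M x : ℤ) : Set where
  field
    d ι : ℤ
    d≅1 : d ≅ 1ℤ [ L ]
    d≅x² : d ≅ x * x [ M ]
    coprime-L : Coprime L d
    coprime-M : Coprime M d
    ι²≅-1 : ι * ι ≅ -1ℤ [ d ]

-- Take d = y² + (L M)² with y ≡ 1 (mod L) and y ≡ x (mod M). Its residues make it prime to L M, so
-- y / (L M) is a square root of -1 modulo d.
splitModulus : ∀ {L M} x → Coprime L M → Coprime x M → SplitModulus L M x
splitModulus {L} {M} x LM xM = build (crt LM 1ℤ x)
  where
  module _ (y : ℤ) (y≅1 : y ≅ 1ℤ [ L ]) (y≅x : y ≅ x [ M ]) where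
    d = y * y + L * M * (L * M)
    dL : d ≅ 1ℤ [ L ]
    dL = sum-of-squares-≅ y 1ℤ (L * M) y≅1 (∣m⇒∣m*n M ∣-refl)
    dM : d ≅ x * x [ M ]
    dM = sum-of-squares-≅ y x (L * M) y≅x (∣n⇒∣m*n L ∣-refl)
    Ld : Coprime L d
    Ld = coprime-sym (coprime-≅ dL coprime-1)
    Md : Coprime M d
    Md = coprime-sym (coprime-≅ dM (coprime-* xM xM))
    finish : (∃ λ w' → L * M * w' ≅ 1ℤ [ d ]) → SplitModulus L M x
    finish (w' , e) = record { d = d ; ι = y * w' ; d≅1 = dL ; d≅x² = dM ; coprime-L = Ld ; coprime-M = Md ; ι²≅-1 = sqrt-1 y (L * M) w' e }
  build : (∃ λ y → y ≅ 1ℤ [ L ] × y ≅ x [ M ]) → SplitModulus L M x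
  build (y , e , e') = finish y e e' (inverse (coprime-* (Ld y e e') (Md y e e')))

-- The congruences modulo L keep the new data close to c, those modulo M steer them to v, and `d∣G`
-- makes m an integer.
record Sheared {h k : ℤ} (c : Config h k) {D : ℤ} (L M : ℤ) (v : LocalConfig h k D (Config.b₁ c) (Config.b₂ c) M) : Set where
  private
    module C = Config c
    module V = LocalConfig v
  field
    d l a₁ a₂ c₁ c₂ : ℤ
    det-eq : a₁ * c₂ - a₂ * c₁ ≡ C.a₁ * C.b₂ - C.a₂ * C.b₁
    d≅L : d ≅ 1ℤ [ L ]
    lL : l ≅ 0ℤ [ L ]
    a₁L : a₁ ≅ C.a₁ [ L ]
    a₂L : a₂ ≅ C.a₂ [ L ]
    c₁L : c₁ ≅ C.b₁ [ L ]
    c₂L : c₂ ≅ C.b₂ [ L ]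
    dM : Coprime d M
    Dd≅ : D * d ≅ V.a₁ * V.b₂ - V.a₂ * V.b₁ [ M ]
    lM : l ≅ 0ℤ [ M ]
    a₁M : a₁ ≅ V.a₁ [ M ]
    a₂M : a₂ ≅ V.a₂ [ M ]
    c₁M : d * c₁ ≅ V.b₁ [ M ]
    c₂M : d * c₂ ≅ V.b₂ [ M ]
    d∣G : d ∣ nrm a₁ a₂ * l * l - (nrm a₁ a₂ + h) * l - k

shearA-0 : ∀ a c → (1ℤ + 0ℤ * 0ℤ) * a + (0ℤ + 0ℤ + 0ℤ * 0ℤ * 0ℤ) * c ≡ a
shearA-0 = solve-∀

shearC-0 : ∀ a c → 0ℤ * a + (1ℤ + 0ℤ * 0ℤ) * c ≡ c
shearC-0 = solve-∀

-- The parameters are glued from three moduli: 0 modulo L, those of `shear-to-pair` modulo M, those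
-- of `shear-to-norm` modulo d. Likewise l is 0 modulo L M and 2 modulo d. Within L, the factor K
-- preserves old congruences, `auxFactor` supplies units modulo d, and 2 `det` will allow exact
-- division in the formula for P.
shear : ∀ {h k} (c : Config h k) K {M} → let open Config c; L = K * auxFactor c * (+ 2 * det c) in
  Coprime L M → (v : LocalConfig h k (det c) b₁ b₂ M) → Sheared c L M v
shear {h} {k} c K {M} LM v = fromModulus (splitModulus V.x LM V.x-unit)
  where
  module C = Config c
  module V = LocalConfig v
  D = det c
  N₀ = nrm C.a₁ C.a₂
  W = N₀ * (k + + 2 * h) - + 2
  L = K * auxFactor c * (+ 2 * D)

  module _ (S : SplitModulus L M V.x) where
    open SplitModulus S

    aux-d : Coprime (auxFactor c) d
    aux-d = coprime-*ʳ K (coprime-*ˡ (+ 2 * D) coprime-L)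
    2D-d : Coprime (+ 2 * D) d
    2D-d = coprime-*ʳ (K * auxFactor c) coprime-L
    2-d : Coprime (+ 2) d
    2-d = coprime-*ˡ D 2D-d
    N₀W-d : Coprime (N₀ * W) d
    N₀W-d = coprime-*ʳ (+ 2) aux-d
    D-M : Coprime D M
    D-M = coprime-*ʳ (+ 2) (coprime-*ʳ (K * auxFactor c) LM)
    d-M : Coprime d M
    d-M = coprime-sym coprime-M
    det≅ : D * d ≅ V.a₁ * V.b₂ - V.a₂ * V.b₁ [ M ]
    det≅ = ≅-trans (*-cong-≅ (≅-refl {a = D}) d≅x²) V.det

    fromLocal :
      (∃₂ λ ξ η → + 2 * nrm (shearA ξ η 0ℤ C.a₁ C.b₁) (shearA ξ η 0ℤ C.a₂ C.b₂) ≅ k + + 2 * h [ d ]) →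
      (∃₂ λ ξ η → ∃ λ ζ → (shearA ξ η ζ C.a₁ C.b₁ ≅ V.a₁ [ M ] × shearA ξ η ζ C.a₂ C.b₂ ≅ V.a₂ [ M ]) ×
        (d * shearC η ζ C.a₁ C.b₁ ≅ V.b₁ [ M ] × d * shearC η ζ C.a₂ C.b₂ ≅ V.b₂ [ M ])) →
      Sheared c L M v
    fromLocal (ξd , ηd , norm-d) (ξM , ηM , ζM , (aM₁ , aM₂) , (cM₁ , cM₂)) =
      combine (crt₃ LM coprime-L coprime-M 0ℤ ξM ξd) (crt₃ LM coprime-L coprime-M 0ℤ ηM ηd)
              (crt₃ LM coprime-L coprime-M 0ℤ ζM 0ℤ) (crt (coprime-* coprime-L coprime-M) 0ℤ (+ 2))
      where
      combine : (∃ λ ξ → ξ ≅ 0ℤ [ L ] × ξ ≅ ξM [ M ] × ξ ≅ ξd [ d ]) →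
                (∃ λ η → η ≅ 0ℤ [ L ] × η ≅ ηM [ M ] × η ≅ ηd [ d ]) →
                (∃ λ ζ → ζ ≅ 0ℤ [ L ] × ζ ≅ ζM [ M ] × ζ ≅ 0ℤ [ d ]) →
                (∃ λ l → l ≅ 0ℤ [ L * M ] × l ≅ + 2 [ d ]) → Sheared c L M v
      combine (ξ , ξ≅L , ξ≅M , ξ≅d) (η , η≅L , η≅M , η≅d) (ζ , ζ≅L , ζ≅M , ζ≅d) (l , l≅LM , l≅d) = record
        { d = d ; l = l
        ; a₁ = shearA ξ η ζ C.a₁ C.b₁ ; a₂ = shearA ξ η ζ C.a₂ C.b₂
        ; c₁ = shearC η ζ C.a₁ C.b₁ ; c₂ = shearC η ζ C.a₂ C.b₂
        ; det-eq = shear-det C.a₁ C.a₂ C.b₁ C.b₂ ξ η ζ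
        ; d≅L = d≅1
        ; lL = ≅-weaken (∣m⇒∣m*n M ∣-refl) l≅LM
        ; a₁L = aL C.a₁ C.b₁ ; a₂L = aL C.a₂ C.b₂ ; c₁L = cL C.a₁ C.b₁ ; c₂L = cL C.a₂ C.b₂
        ; dM = d-M ; Dd≅ = det≅
        ; lM = ≅-weaken (∣n⇒∣m*n L ∣-refl) l≅LM
        ; a₁M = ≅-trans (aM C.a₁ C.b₁) aM₁ ; a₂M = ≅-trans (aM C.a₂ C.b₂) aM₂
        ; c₁M = ≅-trans (cM C.a₁ C.b₁) cM₁ ; c₂M = ≅-trans (cM C.a₂ C.b₂) cM₂
        ; d∣G = quadratic-at-2 (nrm (shearA ξ η ζ C.a₁ C.b₁) (shearA ξ η ζ C.a₂ C.b₂)) l h k l≅d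
            (≅-trans (*-cong-≅ (≅-refl {a = + 2}) (nrm-cong (ad C.a₁ C.b₁) (ad C.a₂ C.b₂))) norm-d)
        }
        where
        aL : ∀ a c → shearA ξ η ζ a c ≅ a [ L ]
        aL a c = ≅-trans (shearA-cong a c ξ≅L η≅L ζ≅L) (≅-reflexive (shearA-0 a c))
        cL : ∀ a c → shearC η ζ a c ≅ c [ L ]
        cL a c = ≅-trans (shearC-cong a c η≅L ζ≅L) (≅-reflexive (shearC-0 a c))
        aM : ∀ a c → shearA ξ η ζ a c ≅ shearA ξM ηM ζM a c [ M ]
        aM a c = shearA-cong a c ξ≅M η≅M ζ≅M
        cM : ∀ a c → d * shearC η ζ a c ≅ d * shearC ηM ζM a c [ M ]
        cM a c = *-cong-≅ (≅-refl {a = d}) (shearC-cong a c η≅M ζ≅M)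
        ad : ∀ a c → shearA ξ η ζ a c ≅ shearA ξd ηd 0ℤ a c [ d ]
        ad a c = shearA-cong a c ξ≅d η≅d ζ≅d

    fromModulus : Sheared c L M v
    fromModulus = fromLocal
      (shear-to-norm C.a₁ C.a₂ C.b₁ C.b₂ (k + + 2 * h) ι ι²≅-1
        (coprime-* 2-d 2-d) (coprime-*ˡ W N₀W-d) (coprime-*ʳ (+ 2) 2D-d) (coprime-*ʳ N₀ N₀W-d))
      (shear-to-pair C.a₁ C.a₂ C.b₁ C.b₂ d V.a₁ V.a₂ V.b₁ V.b₂ D-M d-M V.b-unit det≅)

drop-multiple : ∀ l a d c c₀ {n} → l ≅ 0ℤ [ n ] → d ≅ 1ℤ [ n ] → c ≅ c₀ [ n ] → l * a + d * c ≅ c₀ [ n ]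
drop-multiple l a d c c₀ e₁ e₂ e₃ = ≅! (a ⊛ e₁ ⊕ c ⊛ e₂ ⊕ δ e₃ by solve (l ∷ a ∷ d ∷ c ∷ c₀ ∷ []))

det-expand : ∀ a₁ a₂ c₁ c₂ l d → a₁ * (l * a₂ + d * c₂) - a₂ * (l * a₁ + d * c₁) ≡ d * (a₁ * c₂ - a₂ * c₁)
det-expand = solve-∀

≅-neg-left : ∀ x y {n} → x ≅ - y [ n ] → - x ≅ y [ n ]
≅-neg-left x y e = ≅! (-1ℤ ⊛ e by solve (x ∷ y ∷ []))

-- L is even, so d is odd.
even≢ : ∀ {d L} → + 2 ∣ L → d ≅ 1ℤ [ L ] → d ≢ 0ℤ
even≢ 2∣L e refl = from-no (2 ℕ.∣? 1) (∣⇒∣ᵤ (∣-trans 2∣L (δ e)))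

module _ {h k : ℤ} (c : Config h k) (K : ℤ) {M : ℤ}
         (LM : Coprime (K * auxFactor c * (+ 2 * det c)) M)
         (v : LocalConfig h k (det c) (Config.b₁ c) (Config.b₂ c) M) where
  private
    module C = Config c
    module V = LocalConfig v
    D L : ℤ
    D = det c
    L = K * auxFactor c * (+ 2 * D)

  Approximation : Set
  Approximation = ∃ λ c' → c' ≃ c [ K ] × Config.p₁ c' ≅ V.p₁ [ M ] × Config.p₂ c' ≅ V.p₂ [ M ]

  module _ (S : Sheared c L M v) where
    open Sheared S

    private
      N T s m κ : ℤ
      N = a₁ * a₁ + a₂ * a₂
      T = c₁ * c₁ + c₂ * c₂
      s = a₁ * c₁ + a₂ * c₂
      m = _∣_.quotient d∣G
      κ = m + + 2 * l * s + d * T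

      md≡ : m * d ≡ N * l * l - (N + h) * l - k
      md≡ = sym (_∣_.equality d∣G)

      md≅ : ∀ {n} → l ≅ 0ℤ [ n ] → m * d ≅ - k [ n ]
      md≅ e = ≅-trans (≅-reflexive md≡) (quadratic-at-0 N l h k e)

      numeratorL : ∀ c a β α → d * c ≅ β [ L ] → a ≅ α [ L ] →
        - (h + N) * c + κ * a ≅ - (h + (C.a₁ * C.a₁ + C.a₂ * C.a₂)) * β + (C.b₁ * C.b₁ + C.b₂ * C.b₂ - k) * α [ L ]
      -- Modulo L the extra factor d of `numerator-mod` is 1.
      numeratorL c a β α e e' = 1-*-cancel d (- (h + N) * c + κ * a) (- (h + (C.a₁ * C.a₁ + C.a₂ * C.a₂)) * β + (C.b₁ * C.b₁ + C.b₂ * C.b₂ - k) * α) d≅L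
        (numerator-mod h k N (C.a₁ * C.a₁ + C.a₂ * C.a₂) d c β T (C.b₁ * C.b₁ + C.b₂ * C.b₂) l m a α s
          (nrm-cong a₁L a₂L) e (square-scale d c₁ c₂ C.b₁ C.b₂ (1-* d c₁ C.b₁ d≅L c₁L) (1-* d c₂ C.b₂ d≅L c₂L)) lL (md≅ lL) e')

      lift₁ : ∃ λ p → + 2 * D * p ≡ - (h + N) * c₂ + κ * a₂ × p ≅ C.p₁ [ K ]
      lift₁ = exact-lift (+ 2 * D) C.p₁ (- (h + N) * c₂ + κ * a₂) K (auxFactor c)
        (≅-trans (numeratorL c₂ a₂ C.b₂ C.a₂ (1-* d c₂ C.b₂ d≅L c₂L) a₂L)
          (cramer₁ h k C.p₁ C.p₂ C.a₁ C.a₂ C.b₁ C.b₂ (≅-reflexive C.eqA) (≅-reflexive C.eqB)))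

      lift₂ : ∃ λ p → + 2 * D * p ≡ - (h + N) * c₁ + κ * a₁ × p ≅ - C.p₂ [ K ]
      lift₂ = exact-lift (+ 2 * D) (- C.p₂) (- (h + N) * c₁ + κ * a₁) K (auxFactor c)
        (≅-trans (numeratorL c₁ a₁ C.b₁ C.a₁ (1-* d c₁ C.b₁ d≅L c₁L) a₁L)
          (cramer₂ h k C.p₁ C.p₂ C.a₁ C.a₂ C.b₁ C.b₂ (≅-reflexive C.eqA) (≅-reflexive C.eqB)))

      numeratorM : ∀ c a β α → d * c ≅ β [ M ] → a ≅ α [ M ] →
        d * (- (h + N) * c + κ * a) ≅ - (h + (V.a₁ * V.a₁ + V.a₂ * V.a₂)) * β + (V.b₁ * V.b₁ + V.b₂ * V.b₂ - k) * α [ M ]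
      numeratorM c a β α e e' = numerator-mod h k N (V.a₁ * V.a₁ + V.a₂ * V.a₂) d c β T (V.b₁ * V.b₁ + V.b₂ * V.b₂) l m a α s
          (nrm-cong a₁M a₂M) e (square-scale d c₁ c₂ V.b₁ V.b₂ c₁M c₂M) lM (md≅ lM) e'

      2D-M : Coprime (+ 2 * D) M
      2D-M = coprime-*ʳ (K * auxFactor c) LM

      2-M : Coprime (+ 2) M
      2-M = coprime-*ˡ D 2D-M

      D-M : Coprime D M
      D-M = coprime-*ʳ (+ 2) 2D-M

      cancelM : ∀ p u X → + 2 * D * p ≡ X → d * X ≅ + 2 * (V.a₁ * V.b₂ - V.a₂ * V.b₁) * u [ M ] → p ≅ u [ M ]
      cancelM p u X refl e' = coprime-cancel {+ 2 * (D * d)} (coprime-* 2-M (coprime-* D-M dM))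
        (rescale-mod d D p u (V.a₁ * V.b₂ - V.a₂ * V.b₁) e' Dd≅)

      weak : ∀ {y z} → y ≅ z [ L ] → y ≅ z [ K ]
      weak = ≅-weaken (∣m⇒∣m*n (+ 2 * D) (∣m⇒∣m*n (auxFactor c) ∣-refl))

      det'≢0 : a₁ * c₂ - a₂ * c₁ ≢ 0ℤ
      det'≢0 e = C.det≢0 (trans (sym det-eq) e)

      d≢0 : d ≢ 0ℤ
      d≢0 = even≢ (∣n⇒∣m*n (K * auxFactor c) (∣m⇒∣m*n D ∣-refl)) d≅L

      assemble : (∃ λ p → + 2 * D * p ≡ - (h + N) * c₂ + κ * a₂ × p ≅ C.p₁ [ K ]) →
                 (∃ λ p → + 2 * D * p ≡ - (h + N) * c₁ + κ * a₁ × p ≅ - C.p₂ [ K ]) → Approximation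
      assemble (p₁ , e₁ , p₁≅) (p₂' , e₂ , p₂≅) =
        -- The second formula yields - P₂, so its quotient enters with the opposite sign.
        record { p₁ = p₁ ; p₂ = - p₂' ; a₁ = a₁ ; a₂ = a₂ ; b₁ = l * a₁ + d * c₁ ; b₂ = l * a₂ + d * c₂
               ; eqA = family₁ a₁ a₂ c₁ c₂ h k l d m p₁ (- p₂') det'≢0 num₁ num₂
               ; eqB = family₂ a₁ a₂ c₁ c₂ h k l d m p₁ (- p₂') det'≢0 num₁ num₂ md≡
               ; det≢0 = λ e → [ d≢0 , det'≢0 ]′ (ℤ.i*j≡0⇒i≡0∨j≡0 d (trans (sym (det-expand a₁ a₂ c₁ c₂ l d)) e)) }
        , record { p₁≅ = p₁≅ ; p₂≅ = ≅-neg-left p₂' C.p₂ p₂≅ ; a₁≅ = weak a₁L ; a₂≅ = weak a₂L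
                 ; b₁≅ = weak (drop-multiple l a₁ d c₁ C.b₁ lL d≅L c₁L)
                 ; b₂≅ = weak (drop-multiple l a₂ d c₂ C.b₂ lL d≅L c₂L) }
        , cancelM p₁ V.p₁ _ e₁ (≅-trans (numeratorM c₂ a₂ V.b₂ V.a₂ c₂M a₂M)
            (cramer₁ h k V.p₁ V.p₂ V.a₁ V.a₂ V.b₁ V.b₂ V.eqA V.eqB))
        , ≅-neg-left p₂' V.p₂ (cancelM p₂' (- V.p₂) _ e₂ (≅-trans (numeratorM c₁ a₁ V.b₁ V.a₁ c₁M a₁M)
            (cramer₂ h k V.p₁ V.p₂ V.a₁ V.a₂ V.b₁ V.b₂ V.eqA V.eqB)))
        where
        num₁ : + 2 * (a₁ * c₂ - a₂ * c₁) * p₁ ≡ - (h + N) * c₂ + κ * a₂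
        num₁ = trans (cong (λ D → + 2 * D * p₁) det-eq) e₁
        num₂ : + 2 * (a₁ * c₂ - a₂ * c₁) * - (- p₂') ≡ - (h + N) * c₁ + κ * a₁
        num₂ = trans (cong₂ (λ D p → + 2 * D * p) det-eq (ℤ.neg-involutive p₂')) e₂

    fromSheared : Approximation
    fromSheared = assemble lift₁ lift₂

  -- Weak approximation for triples of points with fixed h and k: K protects what has been achieved,
  -- while the coprime modulus M imposes a new residue on P.
  approximate : Approximation
  approximate = fromSheared (shear c K LM v)

-- Configurations modulo p²

nrm-turn : ∀ x y → - y * - y + x * x ≡ x * x + y * y
nrm-turn = solve-∀

nrm-flip : ∀ x y → x * x + - y * - y ≡ x * x + y * y
nrm-flip = solve-∀

nrm-neg : ∀ x y → - x * - x + - y * - y ≡ x * x + y * y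
nrm-neg = solve-∀

record Points (n₁ n₂ n₃ M : ℤ) : Set where
  field
    p₁ p₂ q₁ q₂ r₁ r₂ : ℤ
    nrmP : nrm p₁ p₂ ≅ n₁ [ M ]
    nrmQ : nrm q₁ q₂ ≅ n₂ [ M ]
    nrmR : nrm r₁ r₂ ≅ n₃ [ M ]

cross : ∀ {n₁ n₂ n₃ M} → Points n₁ n₂ n₃ M → ℤ
cross P = (q₁ - p₁) * (r₂ - p₂) - (q₂ - p₂) * (r₁ - p₁)
  where open Points P

-- Rotation by a right angle keeps the norms and `cross` but changes the direction of B; the
-- reflection `flip` keeps the norms and reverses the sign of `cross`.
turn : ∀ {n₁ n₂ n₃ M} → Points n₁ n₂ n₃ M → Points n₁ n₂ n₃ M
turn P = record
  { p₁ = - p₂ ; p₂ = p₁ ; q₁ = - q₂ ; q₂ = q₁ ; r₁ = - r₂ ; r₂ = r₁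
  ; nrmP = ≅-trans (≅-reflexive (nrm-turn p₁ p₂)) nrmP
  ; nrmQ = ≅-trans (≅-reflexive (nrm-turn q₁ q₂)) nrmQ
  ; nrmR = ≅-trans (≅-reflexive (nrm-turn r₁ r₂)) nrmR }
  where open Points P

flip : ∀ {n₁ n₂ n₃ M} → Points n₁ n₂ n₃ M → Points n₁ n₂ n₃ M
flip P = record
  { p₁ = p₁ ; p₂ = - p₂ ; q₁ = q₁ ; q₂ = - q₂ ; r₁ = r₁ ; r₂ = - r₂
  ; nrmP = ≅-trans (≅-reflexive (nrm-flip p₁ p₂)) nrmP
  ; nrmQ = ≅-trans (≅-reflexive (nrm-flip q₁ q₂)) nrmQ
  ; nrmR = ≅-trans (≅-reflexive (nrm-flip r₁ r₂)) nrmR }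
  where open Points P

cross-turn : ∀ p₁ p₂ q₁ q₂ r₁ r₂ →
  (- q₂ - - p₂) * (r₁ - p₁) - (q₁ - p₁) * (- r₂ - - p₂) ≡ (q₁ - p₁) * (r₂ - p₂) - (q₂ - p₂) * (r₁ - p₁)
cross-turn = solve-∀

cross-flip : ∀ p₁ p₂ q₁ q₂ r₁ r₂ →
  (q₁ - p₁) * (- r₂ - - p₂) - (- q₂ - - p₂) * (r₁ - p₁) ≡ - ((q₁ - p₁) * (r₂ - p₂) - (q₂ - p₂) * (r₁ - p₁))
cross-flip = solve-∀

-- The first square is that of the scalar product, written up to sign as the determinant of the
-- turned vector (- u₂, u₁) with v.
brahmagupta : ∀ u₁ u₂ v₁ v₂ → (u₁ * u₁ + u₂ * u₂) * (v₁ * v₁ + v₂ * v₂) ≡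
  (- u₂ * v₂ - u₁ * v₁) * (- u₂ * v₂ - u₁ * v₁) + (u₁ * v₂ - u₂ * v₁) * (u₁ * v₂ - u₂ * v₁)
brahmagupta = solve-∀

both-signs : ∀ p₁ p₂ q₁ q₂ r₁ r₂ → - + 2 * (q₁ * p₂ - q₂ * p₁) ≡
  ((q₁ - p₁) * (r₂ - p₂) - (q₂ - p₂) * (r₁ - p₁)) + ((q₁ - p₁) * (- r₂ - p₂) - (q₂ - p₂) * (- r₁ - p₁))
both-signs = solve-∀

difference-norm : ∀ p₁ p₂ q₁ q₂ n₁ n₂ {M} → nrm p₁ p₂ ≅ n₁ [ M ] → nrm q₁ q₂ ≅ n₂ [ M ] →
  (q₁ - p₁) * (q₁ - p₁) + (q₂ - p₂) * (q₂ - p₂) + + 2 * ((q₁ - p₁) * p₁ + (q₂ - p₂) * p₂) ≅ n₂ - n₁ [ M ]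
difference-norm p₁ p₂ q₁ q₂ n₁ n₂ eP eQ = combine eP eQ
  where
  combine : ∀ {M} → p₁ * p₁ + p₂ * p₂ ≅ n₁ [ M ] → q₁ * q₁ + q₂ * q₂ ≅ n₂ [ M ] →
    (q₁ - p₁) * (q₁ - p₁) + (q₂ - p₂) * (q₂ - p₂) + + 2 * ((q₁ - p₁) * p₁ + (q₂ - p₂) * p₂) ≅ n₂ - n₁ [ M ]
  combine eP eQ = ≅! (δ eQ ⊕ -1ℤ ⊛ eP by solve (p₁ ∷ p₂ ∷ q₁ ∷ q₂ ∷ n₁ ∷ n₂ ∷ []))

turned : ∀ p₁ p₂ r₁ r₂ c₁ c₂ → (- r₂ - - p₂) * c₂ - (r₁ - p₁) * c₁ ≡ - (r₂ - p₂) * c₂ - (r₁ - p₁) * c₁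
turned = solve-∀

unscale : ∀ D D' x y e {n} → D * D' ≅ 1ℤ [ n ] → x ≅ D' * y [ n ] → y ≡ e → D * x ≅ e [ n ]
unscale D D' x y _ h₁ h₂ refl = ≅! (D ⊛ h₂ ⊕ y ⊛ h₁ by solve (D ∷ D' ∷ x ∷ y ∷ []))

neg-scale : ∀ D' y → - (D' * y) ≡ D' * - y
neg-scale = solve-∀

module Local {p : ℕ} (pp : Prime p) (p%4 : p ℕ.% 4 ≡ 3) where
  open ThreeModFour pp p%4

  private
    ℓ M : ℤ
    ℓ = + p
    M = ℓ * ℓ

  ∤-* : ∀ {a b} → ¬ (ℓ ∣ a) → ¬ (ℓ ∣ b) → ¬ (ℓ ∣ a * b)
  ∤-* {a} {b} ∤a ∤b d = [ ∤a , ∤b ]′ (prime∣* pp a b d)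

  -- If p divided both, it would divide |u|² |v|². So u, or u turned by a right angle, is
  -- independent of v modulo p.
  cross-or-dot : ∀ u₁ u₂ v₁ v₂ → ¬ (ℓ ∣ nrm u₁ u₂) → ¬ (ℓ ∣ nrm v₁ v₂) →
    ¬ (ℓ ∣ u₁ * v₂ - u₂ * v₁) ⊎ ¬ (ℓ ∣ - u₂ * v₂ - u₁ * v₁)
  cross-or-dot u₁ u₂ v₁ v₂ ∤u ∤v = choose (divides? ℓ (u₁ * v₂ - u₂ * v₁)) (divides? ℓ (- u₂ * v₂ - u₁ * v₁))
    where
    choose : Dec (ℓ ∣ u₁ * v₂ - u₂ * v₁) → Dec (ℓ ∣ - u₂ * v₂ - u₁ * v₁) →
      ¬ (ℓ ∣ u₁ * v₂ - u₂ * v₁) ⊎ ¬ (ℓ ∣ - u₂ * v₂ - u₁ * v₁)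
    choose (no ∤c) _ = inj₁ ∤c
    choose (yes _) (no ∤d) = inj₂ ∤d
    choose (yes c) (yes d) = ⊥-elim (∤-* ∤u ∤v
      (∣n⇒∣m*n (- u₂ * v₂ - u₁ * v₁) d ⊕ ∣n⇒∣m*n (u₁ * v₂ - u₂ * v₁) c by brahmagupta u₁ u₂ v₁ v₂))

  unit-∤ : ∀ {x n} → Coprime n ℓ → x ≅ n [ M ] → ¬ (ℓ ∣ x)
  unit-∤ c e d = ¬∣-coprime pp c (∣-≅ (≅-sym (≅-weaken (∣m⇒∣m*n ℓ ∣-refl) e)) d)

  module _ {n₁ n₂ n₃ : ℤ} (c₁ : Coprime n₁ ℓ) (c₂ : Coprime n₂ ℓ) (c₃ : Coprime n₃ ℓ) where

    -- Turning Q if necessary makes P and Q independent modulo p. Then R or - R works, since the two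
    -- values of `cross` add up to - 2 det(Q, P).
    noncollinear : ∃ λ (P : Points n₁ n₂ n₃ M) → ¬ (ℓ ∣ cross P)
    noncollinear = start (sum-of-squares² n₁ c₁) (sum-of-squares² n₂ c₂) (sum-of-squares² n₃ c₃)
      where
      Rep : ℤ → Set
      Rep n = ∃₂ λ x y → x * x + y * y ≅ n [ M ]
      chooseR : (P : Points n₁ n₂ n₃ M) → let open Points P in ¬ (ℓ ∣ q₁ * p₂ - q₂ * p₁) →
        ∃ λ (P : Points n₁ n₂ n₃ M) → ¬ (ℓ ∣ cross P)
      chooseR P ∤qp = choose (divides? ℓ (cross P)) (divides? ℓ (cross P'))
        where
        open Points P
        P' : Points n₁ n₂ n₃ M
        P' = record { p₁ = p₁ ; p₂ = p₂ ; q₁ = q₁ ; q₂ = q₂ ; r₁ = - r₁ ; r₂ = - r₂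
                    ; nrmP = nrmP ; nrmQ = nrmQ ; nrmR = ≅-trans (≅-reflexive (nrm-neg r₁ r₂)) nrmR }
        choose : Dec (ℓ ∣ cross P) → Dec (ℓ ∣ cross P') → ∃ λ (P : Points n₁ n₂ n₃ M) → ¬ (ℓ ∣ cross P)
        choose (no ∤) _ = P , ∤
        choose (yes _) (no ∤) = P' , ∤
        choose (yes d) (yes d') = ⊥-elim (∤-* {a = - + 2} (¬∣-coprime pp (coprime-neg 2-coprime)) ∤qp
          (d ⊕ d' by both-signs p₁ p₂ q₁ q₂ r₁ r₂))
      start : Rep n₁ → Rep n₂ → Rep n₃ → ∃ λ (P : Points n₁ n₂ n₃ M) → ¬ (ℓ ∣ cross P)
      start (p₁ , p₂ , eP) (q₁ , q₂ , eQ) (r₁ , r₂ , eR) =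
        [ chooseR (record { p₁ = p₁ ; p₂ = p₂ ; q₁ = q₁ ; q₂ = q₂ ; r₁ = r₁ ; r₂ = r₂ ; nrmP = eP ; nrmQ = eQ ; nrmR = eR })
        , chooseR (record { p₁ = p₁ ; p₂ = p₂ ; q₁ = - q₂ ; q₂ = q₁ ; r₁ = r₁ ; r₂ = r₂ ; nrmP = eP
                          ; nrmQ = ≅-trans (≅-reflexive (nrm-turn q₁ q₂)) eQ ; nrmR = eR })
        ]′ (cross-or-dot q₁ q₂ p₁ p₂ (unit-∤ c₂ eQ) (unit-∤ c₁ eP))

    Rooted : ℤ → Points n₁ n₂ n₃ M → Set
    Rooted D P = ∃ λ x → Coprime x ℓ × D * (x * x) ≅ cross P [ M ]

    -- The quotient of `cross` by D is plus or minus a square modulo p²; in the second case a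
    -- reflection corrects the sign.
    rooted : ∀ {D} → Coprime D ℓ → ∃ (Rooted D)
    rooted {D} cD = build noncollinear (inverse (coprime-² cD))
      where
      build : (∃ λ (P : Points n₁ n₂ n₃ M) → ¬ (ℓ ∣ cross P)) → (∃ λ D' → D * D' ≅ 1ℤ [ M ]) → ∃ (Rooted D)
      build (P , ∤c) (D' , e) = choose (±square² (D' * cross P) zc)
        where
        open Points P
        D'-unit : Coprime D' ℓ
        D'-unit = coprime-inverse D (≅-weaken (∣m⇒∣m*n ℓ ∣-refl) e)
        zc : Coprime (D' * cross P) ℓ
        zc = coprime-* D'-unit (prime∤⇒coprime pp ∤c)
        x-unit : ∀ x z → Coprime z ℓ → x * x ≅ z [ M ] → Coprime x ℓ
        x-unit x z c e = root-unit x z c (≅-weaken (∣m⇒∣m*n ℓ ∣-refl) e)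
        choose : (∃ λ x → x * x ≅ D' * cross P [ M ] ⊎ x * x ≅ - (D' * cross P) [ M ]) → ∃ (Rooted D)
        choose (x , inj₁ ex) = P , x , x-unit x (D' * cross P) zc ex , unscale D D' (x * x) (cross P) (cross P) e ex refl
        choose (x , inj₂ ex) = flip P , x , x-unit x (- (D' * cross P)) (coprime-neg zc) ex
          , unscale D D' (x * x) (- cross P) (cross (flip P)) e (≅-trans ex (≅-reflexive (neg-scale D' (cross P))))
              (sym (cross-flip p₁ p₂ q₁ q₂ r₁ r₂))

    -- Modulo p neither the new B nor (c₁, c₂) vanishes, so by anisotropy both have unit norm, and
    -- `cross-or-dot` gives a unit determinant with (c₁, c₂) for B or for B turned. In the latter
    -- case all three points are turned.
    localConfig : ∀ {h k D} c₁ c₂ → n₂ - n₁ ≡ - h → n₃ - n₁ ≡ k → Coprime D ℓ → ¬ (ℓ ∣ c₁ × ℓ ∣ c₂) →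
      ∃ λ (v : LocalConfig h k D c₁ c₂ M) → nrm (LocalConfig.p₁ v) (LocalConfig.p₂ v) ≅ n₁ [ M ]
    localConfig {h} {k} {D} c₁ c₂ eh ek cD ∤c = build (rooted cD)
      where
      config : (P : Points n₁ n₂ n₃ M) → Rooted D P → let open Points P in ¬ (ℓ ∣ (r₁ - p₁) * c₂ - (r₂ - p₂) * c₁) →
        ∃ λ (v : LocalConfig h k D c₁ c₂ M) → nrm (LocalConfig.p₁ v) (LocalConfig.p₂ v) ≅ n₁ [ M ]
      config P (x , cx , ex) ∤b = record
        { p₁ = p₁ ; p₂ = p₂ ; a₁ = q₁ - p₁ ; a₂ = q₂ - p₂ ; b₁ = r₁ - p₁ ; b₂ = r₂ - p₂ ; x = x
        ; eqA = ≅-trans (difference-norm p₁ p₂ q₁ q₂ n₁ n₂ nrmP nrmQ) (≅-reflexive eh)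
        ; eqB = ≅-trans (difference-norm p₁ p₂ r₁ r₂ n₁ n₃ nrmP nrmR) (≅-reflexive ek)
        ; det = ex
        ; x-unit = coprime-² cx
        ; b-unit = coprime-² (prime∤⇒coprime pp ∤b) } , nrmP
        where open Points P
      build : ∃ (Rooted D) → ∃ λ (v : LocalConfig h k D c₁ c₂ M) → nrm (LocalConfig.p₁ v) (LocalConfig.p₂ v) ≅ n₁ [ M ]
      build (P , R@(x , cx , ex)) =
        [ config P R
        , (λ ∤t → config (turn P) (x , cx , ≅-trans ex (≅-reflexive (sym (cross-turn p₁ p₂ q₁ q₂ r₁ r₂))))
                    λ d → ∤t (d by sym (turned p₁ p₂ r₁ r₂ c₁ c₂)))
        ]′ (cross-or-dot (r₁ - p₁) (r₂ - p₂) c₁ c₂ ∤b λ d → ∤c (anisotropicˡ c₁ c₂ d , anisotropicʳ c₁ c₂ d))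
        where
        open Points P
        cross-∤ : ¬ (ℓ ∣ cross P)
        cross-∤ = unit-∤ (coprime-* cD (coprime-* cx cx)) (≅-sym ex)
        ∤b : ¬ (ℓ ∣ nrm (r₁ - p₁) (r₂ - p₂))
        ∤b d = cross-∤ (∣n⇒∣m*n (q₁ - p₁) (anisotropicʳ (r₁ - p₁) (r₂ - p₂) d)
                      ⊕ ∣m⇒∣-m (∣n⇒∣m*n (q₂ - p₂) (anisotropicˡ (r₁ - p₁) (r₂ - p₂) d)))

-- Primes p ≡ 3 (mod 4) outside a given integer

3mod4-factor : ∀ a b → (a ℕ.* b) ℕ.% 4 ≡ 3 → a ℕ.% 4 ≡ 3 ⊎ b ℕ.% 4 ≡ 3
3mod4-factor a b e = residues (a ℕ.% 4) (b ℕ.% 4) (ℕ.m%n<n a 4) (ℕ.m%n<n b 4) (trans (sym (ℕ.%-distribˡ-* a b 4)) e)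
  where
  residues : ∀ r s → r ℕ.< 4 → s ℕ.< 4 → (r ℕ.* s) ℕ.% 4 ≡ 3 → r ≡ 3 ⊎ s ≡ 3
  residues 3 _ _ _ _ = inj₁ refl
  residues _ 3 _ _ _ = inj₂ refl
  residues 0 0 _ _ ()
  residues 0 1 _ _ ()
  residues 0 2 _ _ ()
  residues 1 0 _ _ ()
  residues 1 1 _ _ ()
  residues 1 2 _ _ ()
  residues 2 0 _ _ ()
  residues 2 1 _ _ ()
  residues 2 2 _ _ ()
  residues (suc (suc (suc (suc _)))) _ (s<s (s<s (s<s (s<s ())))) _ _
  residues _ (suc (suc (suc (suc _)))) _ (s<s (s<s (s<s (s<s ())))) _

3mod4-prime-factor : ∀ as → All Prime as → product as ℕ.% 4 ≡ 3 → ∃ λ p → Prime p × p ℕ.% 4 ≡ 3 × p ℕ.∣ product as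
3mod4-prime-factor [] _ ()
3mod4-prime-factor (a ∷ as) (pa All.∷ pas) e = choose (3mod4-factor a (product as) e)
  where
  choose : a ℕ.% 4 ≡ 3 ⊎ product as ℕ.% 4 ≡ 3 → ∃ λ p → Prime p × p ℕ.% 4 ≡ 3 × p ℕ.∣ a ℕ.* product as
  choose (inj₁ ea) = a , pa , ea , ℕ.m∣m*n (product as)
  choose (inj₂ eas) = let p , pp , ep , d = 3mod4-prime-factor as pas eas in p , pp , ep , ℕ.∣n⇒∣m*n a d

-- Euclid: a prime factor ≡ 3 (mod 4) of 4 |z| - 1.
opaque
  3mod4-prime-∤ : ∀ z → z ≢ 0ℤ → ∃ λ p → Prime p × p ℕ.% 4 ≡ 3 × ¬ (+ p ∣ z)
  3mod4-prime-∤ z z≢0 = find (abs z) refl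
    where
    find : ∀ n → abs z ≡ n → ∃ λ p → Prime p × p ℕ.% 4 ≡ 3 × ¬ (+ p ∣ z)
    find zero    e = contradiction (ℤ.∣i∣≡0⇒i≡0 e) z≢0
    find (suc n) e =
      let f = factorise (3 ℕ.+ n ℕ.* 4)
          eq = PrimeFactorisation.isFactorisation f
          p , pp , p%4 , d = 3mod4-prime-factor (PrimeFactorisation.factors f) (PrimeFactorisation.factorsPrime f)
            (trans (cong (ℕ._% 4) (sym eq)) (ℕ.[m+kn]%n≡m%n 3 n 4))
      in p , pp , p%4 , λ p∣z → ℕ.>⇒∤ (ℕ.nonTrivial⇒n>1 p {{prime⇒nonTrivial pp}})
           (ℕ.∣m+n∣m⇒∣n (subst (p ℕ.∣_) (ℕ.+-comm 1 (3 ℕ.+ n ℕ.* 4)) (ℕ.∣m⇒∣m*n 4 (subst (p ℕ.∣_) e (∣⇒∣ᵤ p∣z))))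
             (subst (p ℕ.∣_) (sym eq) d))

-- Blocking the intermediate values

*-≢0 : ∀ {a b} → a ≢ 0ℤ → b ≢ 0ℤ → a * b ≢ 0ℤ
*-≢0 {a} a≢0 b≢0 e = [ a≢0 , b≢0 ]′ (ℤ.i*j≡0⇒i≡0∨j≡0 a e)

nrmℕ : ℤ → ℤ → ℕ
nrmℕ x y = abs x ℕ.* abs x ℕ.+ abs y ℕ.* abs y

square-abs : ∀ x → + (abs x ℕ.* abs x) ≡ x * x
square-abs (+ n)    = ℤ.pos-* n n
square-abs -[1+ n ] = refl

nrm-pos : ∀ x y → + nrmℕ x y ≡ nrm x y
nrm-pos x y = cong₂ _+_ (square-abs x) (square-abs y)

nrm≡0⇒ˡ : ∀ x y → nrmℕ x y ≡ 0 → x ≡ 0ℤ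
nrm≡0⇒ˡ x y e = ℤ.∣i∣≡0⇒i≡0 ([ id , id ]′ (ℕ.m*n≡0⇒m≡0∨n≡0 (abs x) (ℕ.m+n≡0⇒m≡0 (abs x ℕ.* abs x) e)))

nrm≡0⇒ʳ : ∀ x y → nrmℕ x y ≡ 0 → y ≡ 0ℤ
nrm≡0⇒ʳ x y e = nrm≡0⇒ˡ y x (trans (ℕ.+-comm (abs y ℕ.* abs y) _) e)

module _ {h k : ℕ} (c : Config (+ suc h) (+ suc k)) where
  open Config c

  private
    N : ℕ
    N = nrmℕ a₁ a₂

  N≢0 : N ≢ 0
  N≢0 e = det≢0 (zero-det (nrm≡0⇒ˡ a₁ a₂ e) (nrm≡0⇒ʳ a₁ a₂ e))
    where
    zero-det : a₁ ≡ 0ℤ → a₂ ≡ 0ℤ → a₁ * b₂ - a₂ * b₁ ≡ 0ℤ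
    zero-det e e' = cong₂ (λ x y → x * b₂ - y * b₁) e e'

  -- The norm is at least 1, and its cofactor at least 3 because both gaps are positive, so the
  -- product exceeds 2.
  W≢0 : nrm a₁ a₂ * (+ suc k + + 2 * + suc h) - + 2 ≢ 0ℤ
  W≢0 e = ℕ.<-irrefl (sym (ℤ.+-injective pos)) (begin-strict
      2                                <⟨ s≤s (s≤s (s≤s z≤n)) ⟩
      3                                ≤⟨ s≤s (ℕ.m≤n⇒m≤o+n k (s≤s (ℕ.m≤n⇒m≤o+n h (s≤s z≤n)))) ⟩
      suc k ℕ.+ 2 ℕ.* suc h            ≤⟨ ℕ.m≤n*m _ N {{ℕ.≢-nonZero N≢0}} ⟩
      N ℕ.* (suc k ℕ.+ 2 ℕ.* suc h)    ∎)
    where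
    open ℕ.≤-Reasoning
    pos : + (N ℕ.* (suc k ℕ.+ 2 ℕ.* suc h)) ≡ + 2
    pos = trans (ℤ.pos-* N (suc k ℕ.+ 2 ℕ.* suc h)) (trans (cong (_* + (suc k ℕ.+ 2 ℕ.* suc h)) (nrm-pos a₁ a₂)) (ℤ.i-j≡0⇒i≡j _ _ e))

  auxFactor≢0 : auxFactor c ≢ 0ℤ
  auxFactor≢0 = *-≢0 {+ 2} (λ ()) (*-≢0 (λ e → N≢0 (ℤ.+-injective (trans (nrm-pos a₁ a₂) e))) W≢0)

-- A form of exact divisibility by p that depends on z modulo p² only, and so survives later
-- deformations.
Blocked : ℤ → Set
Blocked z = ∃ λ p → Prime p × p ℕ.% 4 ≡ 3 × z ≅ + p [ + p * + p ]

record Step {h k : ℤ} (c : Config h k) (K j : ℤ) : Set where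
  constructor stepped
  field
    config : Config h k
    p : ℕ
    prime : Prime p
    p%4 : p ℕ.% 4 ≡ 3
    agrees : config ≃ c [ K ]
    blocks : nrm (Config.p₁ config) (Config.p₂ config) + j ≅ + p [ + p * + p ]

∣-neg-shift : ∀ j p {n} → n ∣ p → n ∣ - j + p → n ∣ j
∣-neg-shift j p n∣p d = ∣m⇒∣-m d ⊕ n∣p by solve (j ∷ p ∷ [])

shift-h : ∀ j p h → - (h + j) + p - (- j + p) ≡ - h
shift-h = solve-∀

shift-k : ∀ j p k → (k - j) + p - (- j + p) ≡ k
shift-k = solve-∀

∣-shift : ∀ j p {n} → n ∣ p → n ∣ j + p → n ∣ j
∣-shift j p n∣p d = d ⊕ ∣m⇒∣-m n∣p by solve (j ∷ p ∷ [])

norm-blocked : ∀ x j p {n} → x ≅ - j + p [ n ] → x + j ≅ p [ n ]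
norm-blocked x j p e = ≅! (δ e by solve (x ∷ j ∷ p ∷ []))

-- For gaps h and k the target norms modulo p² are p - j for P, p - (h + j) for Q and p + k - j for
-- R, so that |P|² + j ≡ p. They are units because p avoids j, h + j and k - j, which are nonzero as
-- f + j is none of e, f, g.
step : ∀ {h k} (c : Config (+ suc h) (+ suc k)) K → K ≢ 0ℤ → ∀ j → j ≢ 0ℤ → + suc h + j ≢ 0ℤ → + suc k - j ≢ 0ℤ → Step c K j
step {h} {k} c K K≢0 j j≢0 hj≢0 kj≢0 = fromPrime (3mod4-prime-∤ (L * (j * ((+ suc h + j) * (+ suc k - j))))
    (*-≢0 L≢0 (*-≢0 j≢0 (*-≢0 hj≢0 kj≢0))))
  where
  open Config c
  L : ℤ
  L = K * auxFactor c * (+ 2 * det c)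
  L≢0 : L ≢ 0ℤ
  L≢0 = *-≢0 (*-≢0 K≢0 (auxFactor≢0 c)) (*-≢0 {+ 2} (λ ()) det≢0)

  fromPrime : (∃ λ p → Prime p × p ℕ.% 4 ≡ 3 × ¬ (+ p ∣ L * (j * ((+ suc h + j) * (+ suc k - j))))) → Step c K j
  fromPrime (p , pp , p%4 , ∤Z) = fromLocal (localConfig c₁ c₂ c₃ b₁ b₂ (shift-h j ℓ (+ suc h)) (shift-k j ℓ (+ suc k)) cD ∤b)
    where
    open Local pp p%4
    ℓ : ℤ
    ℓ = + p
    ∤L : ¬ (ℓ ∣ L)
    ∤L d = ∤Z (∣m⇒∣m*n _ d)
    ∤j : ¬ (ℓ ∣ j)
    ∤j d = ∤Z (∣n⇒∣m*n L (∣m⇒∣m*n _ d))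
    ∤hj : ¬ (ℓ ∣ + suc h + j)
    ∤hj d = ∤Z (∣n⇒∣m*n L (∣n⇒∣m*n j (∣m⇒∣m*n (+ suc k - j) d)))
    ∤kj : ¬ (ℓ ∣ + suc k - j)
    ∤kj d = ∤Z (∣n⇒∣m*n L (∣n⇒∣m*n j (∣n⇒∣m*n (+ suc h + j) d)))
    c₁ : Coprime (- j + ℓ) ℓ
    c₁ = prime∤⇒coprime pp λ d → ∤j (∣-neg-shift j ℓ ∣-refl d)
    c₂ : Coprime (- (+ suc h + j) + ℓ) ℓ
    c₂ = prime∤⇒coprime pp λ d → ∤hj (∣-neg-shift (+ suc h + j) ℓ ∣-refl d)
    c₃ : Coprime ((+ suc k - j) + ℓ) ℓ
    c₃ = prime∤⇒coprime pp λ d → ∤kj (∣-shift (+ suc k - j) ℓ ∣-refl d)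
    ∤D : ¬ (ℓ ∣ det c)
    ∤D d = ∤L (∣n⇒∣m*n (K * auxFactor c) (∣n⇒∣m*n (+ 2) d))
    cD : Coprime (det c) ℓ
    cD = prime∤⇒coprime pp ∤D
    ∤b : ¬ (ℓ ∣ b₁ × ℓ ∣ b₂)
    ∤b (d₁ , d₂) = ∤D (∣n⇒∣m*n a₁ d₂ ⊕ ∣m⇒∣-m (∣n⇒∣m*n a₂ d₁))
    LM : Coprime L (ℓ * ℓ)
    LM = coprime-² (prime∤⇒coprime pp ∤L)

    fromLocal : (∃ λ (v : LocalConfig (+ suc h) (+ suc k) (det c) b₁ b₂ (ℓ * ℓ)) → nrm (LocalConfig.p₁ v) (LocalConfig.p₂ v) ≅ - j + ℓ [ ℓ * ℓ ]) → Step c K j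
    fromLocal (v , e) = finish (approximate c K LM v)
      where
      finish : Approximation c K LM v → Step c K j
      finish (c' , agrees , e₁ , e₂) = stepped c' p pp p%4 agrees
        (norm-blocked _ j ℓ (≅-trans (nrm-cong e₁ e₂) e))

-- Iteration over the intermediate values

≃-refl : ∀ {h k n} {c : Config h k} → c ≃ c [ n ]
≃-refl = record { p₁≅ = ≅-refl ; p₂≅ = ≅-refl ; a₁≅ = ≅-refl ; a₂≅ = ≅-refl ; b₁≅ = ≅-refl ; b₂≅ = ≅-refl }

≃-trans : ∀ {h k m n} {c c' c'' : Config h k} → m ∣ n → c ≃ c' [ n ] → c' ≃ c'' [ m ] → c ≃ c'' [ m ]
≃-trans d x y = record
  { p₁≅ = ≅-trans (≅-weaken d X.p₁≅) Y.p₁≅ ; p₂≅ = ≅-trans (≅-weaken d X.p₂≅) Y.p₂≅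
  ; a₁≅ = ≅-trans (≅-weaken d X.a₁≅) Y.a₁≅ ; a₂≅ = ≅-trans (≅-weaken d X.a₂≅) Y.a₂≅
  ; b₁≅ = ≅-trans (≅-weaken d X.b₁≅) Y.b₁≅ ; b₂≅ = ≅-trans (≅-weaken d X.b₂≅) Y.b₂≅ }
  where
  module X = _≃_[_] x
  module Y = _≃_[_] y

-- The index i is the distance from e, so the value tested is e + i; the excluded indices belong to
-- e, f and g.
Sifted : ∀ {h k} → Config (+ suc h) (+ suc k) → ℕ → Set
Sifted {h} {k} c n = ∀ i → i ℕ.< n → i ≢ 0 → i ≢ suc h → i ≢ suc h ℕ.+ suc k →
  Blocked (nrm (Config.p₁ c) (Config.p₂ c) + (+ i - + suc h))

add-sub : ∀ h i → h + (i - h) ≡ i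
add-sub = solve-∀

sub-sub : ∀ h k i → k - (i - h) ≡ h + k - i
sub-sub = solve-∀

-- The largest index is blocked first; the smaller ones follow recursively with p² multiplied into
-- the modulus, so that this block persists.
sift : ∀ {h k} n (c : Config (+ suc h) (+ suc k)) K → K ≢ 0ℤ → ∃ λ c' → c' ≃ c [ K ] × Sifted c' n
sift zero c K K≢0 = c , ≃-refl , λ i ()
sift {h} {k} (suc n) c K K≢0 = extend (n ℕ.≟ 0) (n ℕ.≟ suc h) (n ℕ.≟ suc h ℕ.+ suc k)
  where
  Result : Set
  Result = ∃ λ c' → c' ≃ c [ K ] × Sifted c' (suc n)

  split : ∀ {i} → i ℕ.< suc n → i ℕ.< n ⊎ i ≡ n
  split i<1+n = ℕ.m<1+n⇒m<n∨m≡n i<1+n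

  skip : (∀ i → i ≡ n → i ≢ 0 → i ≢ suc h → i ≢ suc h ℕ.+ suc k → ⊥) → Result
  skip absurd = let c' , e , s = sift n c K K≢0 in c' , e , λ i i<1+n x y z →
    [ (λ i<n → s i i<n x y z) , (λ i≡n → ⊥-elim (absurd i i≡n x y z)) ]′ (split i<1+n)

  extend : Dec (n ≡ 0) → Dec (n ≡ suc h) → Dec (n ≡ suc h ℕ.+ suc k) → Result
  extend (yes n≡) _ _ = skip λ i i≡n x _ _ → x (trans i≡n n≡)
  extend _ (yes n≡) _ = skip λ i i≡n _ y _ → y (trans i≡n n≡)
  extend _ _ (yes n≡) = skip λ i i≡n _ _ z → z (trans i≡n n≡)
  extend (no n≢0) (no n≢h) (no n≢hk) = continue (step c K K≢0 j j≢0 hj≢0 kj≢0)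
    where
    j : ℤ
    j = + n - + suc h
    j≢0 : j ≢ 0ℤ
    j≢0 e = n≢h (ℤ.+-injective (ℤ.i-j≡0⇒i≡j (+ n) (+ suc h) e))
    hj≢0 : + suc h + j ≢ 0ℤ
    hj≢0 e = n≢0 (ℤ.+-injective (trans (sym (add-sub (+ suc h) (+ n))) e))
    kj≢0 : + suc k - j ≢ 0ℤ
    kj≢0 e = n≢hk (sym (ℤ.+-injective (ℤ.i-j≡0⇒i≡j (+ (suc h ℕ.+ suc k)) (+ n) (trans (sym (sub-sub (+ suc h) (+ suc k) (+ n))) e))))

    continue : Step c K j → Result
    continue (stepped c₁ p pp p%4 agrees blocks) =
      let c' , e , s = sift n c₁ (K * (+ p * + p)) (*-≢0 K≢0 (*-≢0 p≢0 p≢0))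
      in c' , ≃-trans (∣m⇒∣m*n (+ p * + p) ∣-refl) e agrees , λ i i<1+n x y z →
        [ (λ i<n → s i i<n x y z)
        , (λ i≡n → p , pp , p%4 , subst (λ i → nrm (Config.p₁ c') (Config.p₂ c') + (+ i - + suc h) ≅ + p [ + p * + p ]) (sym i≡n)
            (≅-trans (+-cong-≅ (nrm-cong (≅-weaken p²∣ (_≃_[_].p₁≅ e)) (≅-weaken p²∣ (_≃_[_].p₂≅ e))) (≅-refl {a = j})) blocks))
        ]′ (split i<1+n)
      where
      p≢0 : + p ≢ 0ℤ
      p≢0 e = ℕ.≢-nonZero⁻¹ p {{prime⇒nonZero pp}} (ℤ.+-injective e)
      p²∣ : + p * + p ∣ K * (+ p * + p)
      p²∣ = ∣n⇒∣m*n K ∣-refl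

-- By anisotropy p would divide both x and y, so p² would divide the sum and hence p.
blocked⇒¬InE : ∀ m → Blocked (+ m) → ¬ InE m
blocked⇒¬InE m (p , pp , p%4 , e) (x , y , refl) = ℕ.<⇒≱ (ℕ.m<m*n p p {{prime⇒nonZero pp}} (ℕ.nonTrivial⇒n>1 p {{prime⇒nonTrivial pp}})) p²≤p
  where
  open ThreeModFour pp p%4
  m≡ : + (x ℕ.* x ℕ.+ y ℕ.* y) ≡ + x * + x + + y * + y
  m≡ = nrm-pos (+ x) (+ y)
  p∣ : + p ∣ + x * + x + + y * + y
  p∣ = ∣-≅ (≅-trans (≅-reflexive (sym m≡)) (≅-weaken (∣m⇒∣m*n (+ p) ∣-refl) e)) ∣-refl
  square-∣ : ∀ z → + p ∣ z → + p * + p ∣ z * z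
  square-∣ z d = ∣-trans (*-monoˡ-∣ (+ p) d) (*-monoʳ-∣ z d)
  p²∣p : + p * + p ∣ + p
  p²∣p = ∣-≅ (≅-sym e) (subst (+ p * + p ∣_) (sym m≡)
    (square-∣ (+ x) (anisotropicˡ (+ x) (+ y) p∣) ⊕ square-∣ (+ y) (anisotropicʳ (+ x) (+ y) p∣)))
  p²≤p : p ℕ.* p ℕ.≤ p
  p²≤p = ℕ.∣⇒≤ {{prime⇒nonZero pp}} (subst (ℕ._∣ p) (ℤ.abs-* (+ p) (+ p)) (∣⇒∣ᵤ p²∣p))

≅⇒%≡ : ∀ m n q .{{_ : NonZero q}} → + m ≅ + n [ + q ] → m ℕ.% q ≡ n ℕ.% q
≅⇒%≡ m n q e = [ ordered m n e , (λ n≤m → sym (ordered n m (≅-sym e) n≤m)) ]′ (ℕ.≤-total m n)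
  where
  ordered : ∀ m n → + m ≅ + n [ + q ] → m ℕ.≤ n → m ℕ.% q ≡ n ℕ.% q
  ordered m n e m≤n = gap (∣⇒∣ᵤ (subst (+ q ∣_) (trans (ℤ.m-n≡m⊖n n m) (ℤ.⊖-≥ m≤n)) (δ (≅-sym e))))
    where
    gap : q ℕ.∣ n ℕ.∸ m → m ℕ.% q ≡ n ℕ.% q
    gap (ℕ.divides t eq) = trans (sym (ℕ.[m+kn]%n≡m%n m t q)) (cong (ℕ._% q) (trans (cong (m ℕ.+_) (sym eq)) (ℕ.m+[n∸m]≡n m≤n)))

-- Consecutive sums of two squares

sum-of-squares<square : ∀ u v {x} → suc (u ℕ.+ v) ≤ x → u ℕ.* u ℕ.+ v ℕ.* v ℕ.< x ℕ.* x
sum-of-squares<square u v {x} lt = begin-strict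
  u ℕ.* u ℕ.+ v ℕ.* v                       ≤⟨ ℕ.+-mono-≤ (ℕ.*-monoʳ-≤ u (ℕ.m≤m+n u v)) (ℕ.*-monoʳ-≤ v (ℕ.m≤n+m v u)) ⟩
  u ℕ.* (u ℕ.+ v) ℕ.+ v ℕ.* (u ℕ.+ v)       ≡⟨ sym (ℕ.*-distribʳ-+ (u ℕ.+ v) u v) ⟩
  (u ℕ.+ v) ℕ.* (u ℕ.+ v)                   <⟨ ℕ.*-mono-< lt lt ⟩
  x ℕ.* x                                   ∎
  where open ℕ.≤-Reasoning

gap : ∀ {m n} → m ℕ.< n → ∃ λ d → n ≡ m ℕ.+ suc d
gap {m} {n} m<n = n ℕ.∸ suc m , sym (trans (ℕ.+-suc m (n ℕ.∸ suc m)) (ℕ.m+[n∸m]≡n m<n))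

sum-norm : ∀ p₁ p₂ a₁ a₂ → (p₁ + a₁) * (p₁ + a₁) + (p₂ + a₂) * (p₂ + a₂) ≡
  p₁ * p₁ + p₂ * p₂ + (a₁ * a₁ + a₂ * a₂ + + 2 * (a₁ * p₁ + a₂ * p₂))
sum-norm = solve-∀

difference-norm≡ : ∀ p₁ p₂ q₁ q₂ →
  (q₁ - p₁) * (q₁ - p₁) + (q₂ - p₂) * (q₂ - p₂) + + 2 * ((q₁ - p₁) * p₁ + (q₂ - p₂) * p₂) ≡
  (q₁ * q₁ + q₂ * q₂) - (p₁ * p₁ + p₂ * p₂)
difference-norm≡ = solve-∀

sub-+ : ∀ x y → x - (x + y) ≡ - y
sub-+ = solve-∀

+-sub : ∀ x y → x + y - x ≡ y
+-sub = solve-∀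

module _ {h k : ℕ} (c : Config (+ suc h) (+ suc k)) where
  open Config c

  normE normF normG : ℕ
  normE = nrmℕ (p₁ + a₁) (p₂ + a₂)
  normF = nrmℕ p₁ p₂
  normG = nrmℕ (p₁ + b₁) (p₂ + b₂)

  normF≡ : normF ≡ normE ℕ.+ suc h
  normF≡ = ℤ.+-injective (begin
    + normF                            ≡⟨ nrm-pos p₁ p₂ ⟩
    nrm p₁ p₂                          ≡⟨ sym (cancel (nrm p₁ p₂) (+ suc h)) ⟩
    nrm p₁ p₂ + - + suc h + + suc h    ≡⟨ cong (λ z → nrm p₁ p₂ + z + + suc h) (sym eqA) ⟩
    nrm p₁ p₂ + (a₁ * a₁ + a₂ * a₂ + + 2 * (a₁ * p₁ + a₂ * p₂)) + + suc h
                                       ≡⟨ cong (_+ + suc h) (sym (sum-norm p₁ p₂ a₁ a₂)) ⟩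
    nrm (p₁ + a₁) (p₂ + a₂) + + suc h  ≡⟨ cong (_+ + suc h) (sym (nrm-pos (p₁ + a₁) (p₂ + a₂))) ⟩
    + (normE ℕ.+ suc h)                ∎)
    where
    open ≡-Reasoning
    cancel : ∀ x y → x + - y + y ≡ x
    cancel = solve-∀

  normG≡ : normG ≡ normF ℕ.+ suc k
  normG≡ = ℤ.+-injective (begin
    + normG                            ≡⟨ nrm-pos (p₁ + b₁) (p₂ + b₂) ⟩
    nrm (p₁ + b₁) (p₂ + b₂)            ≡⟨ sum-norm p₁ p₂ b₁ b₂ ⟩
    nrm p₁ p₂ + (b₁ * b₁ + b₂ * b₂ + + 2 * (b₁ * p₁ + b₂ * p₂)) ≡⟨ cong (λ z → nrm p₁ p₂ + z) eqB ⟩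
    nrm p₁ p₂ + + suc k                ≡⟨ cong (_+ + suc k) (sym (nrm-pos p₁ p₂)) ⟩
    + (normF ℕ.+ suc k)                ∎)
    where open ≡-Reasoning

  normG≡E : normG ≡ normE ℕ.+ (suc h ℕ.+ suc k)
  normG≡E = trans normG≡ (trans (cong (ℕ._+ suc k) normF≡) (ℕ.+-assoc normE (suc h) (suc k)))

  E<F : normE ℕ.< normF
  E<F = subst (normE ℕ.<_) (sym normF≡) (ℕ.m<m+n normE z<s)

  F<G : normF ℕ.< normG
  F<G = subst (normF ℕ.<_) (sym normG≡) (ℕ.m<m+n normF z<s)

  sifted⇒gap : Sifted c (suc h ℕ.+ suc k) → ∀ m → normE ℕ.< m → m ℕ.< normG → m ≢ normF → ¬ InE m
  -- The index of m is i + 1: nonzero since m > e, below that of g since m < g, and not that of f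
  -- since m ≠ f.
  sifted⇒gap s m E<m m<G m≢F = blocked⇒¬InE m (subst Blocked m≡ (s (suc i) i<hk (λ ()) i≢h (ℕ.<⇒≢ i<hk)))
    where
    i : ℕ
    i = proj₁ (gap E<m)
    m≡E+i : m ≡ normE ℕ.+ suc i
    m≡E+i = proj₂ (gap E<m)
    i<hk : suc i ℕ.< suc h ℕ.+ suc k
    i<hk = ℕ.+-cancelˡ-< normE (suc i) (suc h ℕ.+ suc k) (subst (ℕ._< normE ℕ.+ (suc h ℕ.+ suc k)) m≡E+i (subst (m ℕ.<_) normG≡E m<G))
    i≢h : suc i ≢ suc h
    i≢h e = m≢F (trans m≡E+i (trans (cong (normE ℕ.+_) e) (sym normF≡)))
    m≡ : nrm p₁ p₂ + (+ suc i - + suc h) ≡ + m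
    m≡ = begin
      nrm p₁ p₂ + (+ suc i - + suc h)            ≡⟨ cong (_+ (+ suc i - + suc h)) (sym (nrm-pos p₁ p₂)) ⟩
      + normF + (+ suc i - + suc h)              ≡⟨ cong (λ z → + z + (+ suc i - + suc h)) normF≡ ⟩
      + normE + + suc h + (+ suc i - + suc h)    ≡⟨ rearrange (+ normE) (+ suc h) (+ suc i) ⟩
      + normE + + suc i                          ≡⟨ cong +_ (sym m≡E+i) ⟩
      + m                                        ∎
      where
      open ≡-Reasoning
      rearrange : ∀ e h i → e + h + (i - h) ≡ e + i
      rearrange = solve-∀

  sifted⇒consecutive : Sifted c (suc h ℕ.+ suc k) → ConsecE normE normF × ConsecE normF normG
  sifted⇒consecutive s =
    ( (abs (p₁ + a₁) , abs (p₂ + a₂) , refl) , (abs p₁ , abs p₂ , refl) , E<F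
    , λ m E<m m<F → sifted⇒gap s m E<m (ℕ.<-trans m<F F<G) (ℕ.<⇒≢ m<F))
    , ((abs p₁ , abs p₂ , refl) , (abs (p₁ + b₁) , abs (p₂ + b₂) , refl) , F<G
    , λ m F<m m<G → sifted⇒gap s m (ℕ.<-trans E<F F<m) m<G (ℕ.>⇒≢ F<m))

-- The initial configuration

module _ (p₁ p₂ q₁ q₂ r₁ r₂ : ℕ) where
  detℕ : ℤ
  detℕ = (+ q₁ - + p₁) * (+ r₂ - + p₂) - (+ q₂ - + p₂) * (+ r₁ - + p₁)

  fromPoints : ∀ {h k} → p₁ ℕ.* p₁ ℕ.+ p₂ ℕ.* p₂ ≡ (q₁ ℕ.* q₁ ℕ.+ q₂ ℕ.* q₂) ℕ.+ suc h →
    r₁ ℕ.* r₁ ℕ.+ r₂ ℕ.* r₂ ≡ (p₁ ℕ.* p₁ ℕ.+ p₂ ℕ.* p₂) ℕ.+ suc k → detℕ ≢ 0ℤ → Config (+ suc h) (+ suc k)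
  fromPoints {h} {k} eh ek det≢0 = record
    { p₁ = + p₁ ; p₂ = + p₂ ; a₁ = + q₁ - + p₁ ; a₂ = + q₂ - + p₂ ; b₁ = + r₁ - + p₁ ; b₂ = + r₂ - + p₂
    ; eqA = trans (difference-norm≡ (+ p₁) (+ p₂) (+ q₁) (+ q₂))
        (trans (cong₂ _-_ (sym (nrm-pos (+ q₁) (+ q₂))) (trans (sym (nrm-pos (+ p₁) (+ p₂))) (cong +_ eh))) (sub-+ (+ (q₁ ℕ.* q₁ ℕ.+ q₂ ℕ.* q₂)) (+ suc h)))
    ; eqB = trans (difference-norm≡ (+ p₁) (+ p₂) (+ r₁) (+ r₂))
        (trans (cong₂ _-_ (trans (sym (nrm-pos (+ r₁) (+ r₂))) (cong +_ ek)) (sym (nrm-pos (+ p₁) (+ p₂)))) (+-sub (+ (p₁ ℕ.* p₁ ℕ.+ p₂ ℕ.* p₂)) (+ suc k)))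
    ; det≢0 = det≢0 }

det-increment : ∀ a b c d e q → (a * (b + q - c) - d * e) - (a * (b - c) - d * e) ≡ a * q
det-increment = solve-∀

-- The determinant is affine in m with nonzero slope (q₁ - p₁) q, so it cannot vanish at both n and
-- n + 1.
nondegenerate : ∀ q .{{_ : NonZero q}} p₁ p₂ q₁ q₂ r₁ r₂ n → q₁ ℕ.< p₁ →
  ∃ λ m → n ≤ m × detℕ p₁ p₂ q₁ q₂ r₁ (r₂ ℕ.+ q ℕ.* m) ≢ 0ℤ
nondegenerate q p₁ p₂ q₁ q₂ r₁ r₂ n q₁<p₁ = choose (D n ℤ.≟ 0ℤ) (D (suc n) ℤ.≟ 0ℤ)
  where
  D : ℕ → ℤ
  D m = detℕ p₁ p₂ q₁ q₂ r₁ (r₂ ℕ.+ q ℕ.* m)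
  next : r₂ ℕ.+ q ℕ.* suc n ≡ (r₂ ℕ.+ q ℕ.* n) ℕ.+ q
  next = trans (cong (r₂ ℕ.+_) (trans (ℕ.*-suc q n) (ℕ.+-comm q (q ℕ.* n)))) (sym (ℕ.+-assoc r₂ (q ℕ.* n) q))
  increment : D (suc n) - D n ≡ (+ q₁ - + p₁) * + q
  increment = trans (cong (λ z → detℕ p₁ p₂ q₁ q₂ r₁ z - D n) next)
    (det-increment (+ q₁ - + p₁) (+ (r₂ ℕ.+ q ℕ.* n)) (+ p₂) (+ q₂ - + p₂) (+ r₁ - + p₁) (+ q))
  increment≢0 : (+ q₁ - + p₁) * + q ≢ 0ℤ
  increment≢0 = *-≢0 (λ e → ℕ.<⇒≢ q₁<p₁ (ℤ.+-injective (ℤ.i-j≡0⇒i≡j (+ q₁) (+ p₁) e)))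
                     (λ e → ℕ.≢-nonZero⁻¹ q (ℤ.+-injective e))
  choose : Dec (D n ≡ 0ℤ) → Dec (D (suc n) ≡ 0ℤ) → ∃ λ m → n ≤ m × D m ≢ 0ℤ
  choose (no D≢0) _ = n , ℕ.≤-refl , D≢0
  choose (yes _) (no D≢0) = suc n , ℕ.n≤1+n n , D≢0
  choose (yes e) (yes e') = ⊥-elim (increment≢0 (trans (sym increment) (cong₂ _-_ e' e)))

add-multiple : ∀ x q n → + (x ℕ.+ q ℕ.* n) ≅ + x [ + q ]
add-multiple x q n = ≅! (divides (+ n) (trans (+-sub (+ x) (+ (q ℕ.* n))) (trans (ℤ.pos-* q n) (ℤ.*-comm (+ q) (+ n)))))

translate-≅ : ∀ p p' a a' q {n} → p ≅ p' [ n ] → a ≅ a' [ n ] → p' + a' ≡ q → p + a ≅ q [ n ]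
translate-≅ p p' a a' q e e' refl = +-cong-≅ e e'

add-difference : ∀ p q → p + (q - p) ≡ q
add-difference = solve-∀

norm-% : ∀ q .{{_ : NonZero q}} x y u v → x ≅ + u [ + q ] → y ≅ + v [ + q ] → nrmℕ x y ℕ.% q ≡ (u ℕ.* u ℕ.+ v ℕ.* v) ℕ.% q
norm-% q x y u v ex ey = ≅⇒%≡ (nrmℕ x y) (u ℕ.* u ℕ.+ v ℕ.* v) q
  (≅-trans (≅-reflexive (nrm-pos x y)) (≅-trans (nrm-cong ex ey) (≅-reflexive (sym (nrm-pos (+ u) (+ v))))))

theorem1p2 : (q : ℕ) → .{{_ : NonZero q}} → (a b c : ℕ) →
    Admissible q a → Admissible q b → Admissible q c →
    (B : ℕ) → Σ[ e ∈ ℕ ] Σ[ f ∈ ℕ ] Σ[ g ∈ ℕ ] (B ≤ e × GoodTriple q a b c e f g)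
theorem1p2 q a b c (xa , ya , ea) (xb , yb , eb) (xc , yc , ec) B =
  -- The third point is (xc, yc + q m), with m large enough for G₀ > F₀ and chosen to avoid
  -- collinearity.
  place (nondegenerate q X yb u ya xc yc (suc (X ℕ.+ yb)) u<X)
  where
  u X : ℕ
  -- Adding multiples of q preserves the residues. Here u ≥ B gives E₀ ≥ B, and X > u + ya gives F₀
  -- > E₀ as well as the nonzero slope of the determinant.
  u = xa ℕ.+ q ℕ.* B
  X = xb ℕ.+ q ℕ.* suc (u ℕ.+ ya)
  E₀ F₀ : ℕ
  E₀ = u ℕ.* u ℕ.+ ya ℕ.* ya
  F₀ = X ℕ.* X ℕ.+ yb ℕ.* yb
  X-large : suc (u ℕ.+ ya) ≤ X
  X-large = ℕ.≤-trans (ℕ.m≤n*m (suc (u ℕ.+ ya)) q) (ℕ.m≤n+m _ xb)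
  u<X : u ℕ.< X
  u<X = ℕ.≤-trans (s≤s (ℕ.m≤m+n u ya)) X-large
  E₀<F₀ : E₀ ℕ.< F₀
  E₀<F₀ = ℕ.<-≤-trans (sum-of-squares<square u ya X-large) (ℕ.m≤m+n (X ℕ.* X) (yb ℕ.* yb))
  m≤m² : ∀ m → m ≤ m ℕ.* m
  m≤m² zero    = z≤n
  m≤m² (suc m) = ℕ.m≤m*n (suc m) (suc m)
  B≤E₀ : B ≤ E₀
  B≤E₀ = ℕ.≤-trans (ℕ.≤-trans (ℕ.m≤n*m B q) (ℕ.m≤n+m (q ℕ.* B) xa)) (ℕ.≤-trans (m≤m² u) (ℕ.m≤m+n (u ℕ.* u) (ya ℕ.* ya)))

  Goal : Set
  Goal = Σ[ e ∈ ℕ ] Σ[ f ∈ ℕ ] Σ[ g ∈ ℕ ] (B ≤ e × GoodTriple q a b c e f g)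

  place : (∃ λ m → suc (X ℕ.+ yb) ≤ m × detℕ X yb u ya xc (yc ℕ.+ q ℕ.* m) ≢ 0ℤ) → Goal
  place (m , m-large , det≢0) = build (gap E₀<F₀) (gap F₀<G₀)
    where
    Y G₀ : ℕ
    Y = yc ℕ.+ q ℕ.* m
    G₀ = xc ℕ.* xc ℕ.+ Y ℕ.* Y
    F₀<G₀ : F₀ ℕ.< G₀
    F₀<G₀ = ℕ.<-≤-trans (sum-of-squares<square X yb (ℕ.≤-trans m-large (ℕ.≤-trans (ℕ.m≤n*m m q) (ℕ.m≤n+m _ yc)))) (ℕ.m≤n+m (Y ℕ.* Y) (xc ℕ.* xc))

    build : (∃ λ h → F₀ ≡ E₀ ℕ.+ suc h) → (∃ λ k → G₀ ≡ F₀ ℕ.+ suc k) → Goal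
    build (h , eh) (k , ek) = conclude (sift (suc h ℕ.+ suc k) c₀ K K≢0)
      where
      c₀ : Config (+ suc h) (+ suc k)
      c₀ = fromPoints X yb u ya xc Y eh ek det≢0
      K : ℤ
      -- The factor q preserves the residue classes, the factor E₀ + 1 the lower bound on e.
      K = + q * + suc E₀
      K≢0 : K ≢ 0ℤ
      K≢0 = *-≢0 {+ q} {+ suc E₀} (λ e → ℕ.≢-nonZero⁻¹ q (ℤ.+-injective e)) (λ ())

      conclude : (∃ λ c' → c' ≃ c₀ [ K ] × Sifted c' (suc h ℕ.+ suc k)) → Goal
      conclude (c' , agrees , sifted) =
        normE c' , normF c' , normG c' , B≤E
        , proj₁ (sifted⇒consecutive c' sifted) , proj₂ (sifted⇒consecutive c' sifted)
        , trans (norm-% q (p₁ + a₁) (p₂ + a₂) xa ya (≅-trans (mod-q Q₁) (add-multiple xa q B)) (mod-q Q₂)) ea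
        , trans (norm-% q p₁ p₂ xb yb (≅-trans (mod-q p₁≅) (add-multiple xb q (suc (u ℕ.+ ya)))) (mod-q p₂≅)) eb
        , trans (norm-% q (p₁ + b₁) (p₂ + b₂) xc yc (mod-q R₁) (≅-trans (mod-q R₂) (add-multiple yc q m))) ec
        where
        open Config c'
        open _≃_[_] agrees
        mod-q : ∀ {x y} → x ≅ y [ K ] → x ≅ y [ + q ]
        mod-q = ≅-weaken (∣m⇒∣m*n (+ suc E₀) ∣-refl)
        Q₁ : p₁ + a₁ ≅ + u [ K ]
        Q₁ = translate-≅ p₁ (+ X) a₁ (+ u - + X) (+ u) p₁≅ a₁≅ (add-difference (+ X) (+ u))
        Q₂ : p₂ + a₂ ≅ + ya [ K ]
        Q₂ = translate-≅ p₂ (+ yb) a₂ (+ ya - + yb) (+ ya) p₂≅ a₂≅ (add-difference (+ yb) (+ ya))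
        R₁ : p₁ + b₁ ≅ + xc [ K ]
        R₁ = translate-≅ p₁ (+ X) b₁ (+ xc - + X) (+ xc) p₁≅ b₁≅ (add-difference (+ X) (+ xc))
        R₂ : p₂ + b₂ ≅ + Y [ K ]
        R₂ = translate-≅ p₂ (+ yb) b₂ (+ Y - + yb) (+ Y) p₂≅ b₂≅ (add-difference (+ yb) (+ Y))
        -- E ≡ E₀ (mod E₀ + 1) and E ≥ 0 force E ≥ E₀.
        B≤E : B ≤ normE c'
        B≤E = ℕ.≤-trans B≤E₀ (subst (_≤ normE c')
          (trans (norm-% (suc E₀) (p₁ + a₁) (p₂ + a₂) u ya (mod-E₀ Q₁) (mod-E₀ Q₂)) (ℕ.m<n⇒m%n≡m (ℕ.n<1+n E₀)))
          (ℕ.m%n≤m (normE c') (suc E₀)))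
          where
          mod-E₀ : ∀ {x y} → x ≅ y [ K ] → x ≅ y [ + suc E₀ ]
          mod-E₀ = ≅-weaken (∣n⇒∣m*n (+ q) ∣-refl)
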